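{- $\mathrm{DSub}_z(n) \in \Theta(\log n)$ as $n \to \infty$; that is, the multiplicative sensitivity of the number of Lempel--Ziv phrases to substring deletion is $\Theta(\log n)$.
   Context: Strings are indexed from $0$: a string $S$ of length $n=|S|$ is $S[0]\cdots S[n-1]$, and $S[i..j]$ is the substring from position $i$ to position $j$. A factorization of $S$ is a sequence of nonempty strings (phrases) $F_1,\dots,F_m$ with $S=F_1\cdots F_m$; the starting position of $F_i$ is $b_i=\sum_{k=1}^{i-1}|F_k|$. The Lempel--Ziv (LZ) factorization of $S$ is built from left to right: if the character $S[b_i]$ has no occurrence in $S$ starting before $b_i$, then $F_i=S[b_i]$; otherwise $F_i$ is the longest prefix of $S[b_i..n-1]$ that has an occurrence in $S$ starting before $b_i$ (this earlier occurrence may overlap $F_i$). The number of phrases is denoted $z(S)$ (with $z$ of the empty string equal to $0$). The sensitivity to substring deletion is $\mathrm{DSub}_z(n)=\max\{ z(AC)/z(ABC) : A,B,C \in\Sigma^*,\ |ABC|=n\}$, where $A,B,C$ range over all (possibly empty) strings over an alphabet $\Sigma$ of unrestricted size (i.e. strings over arbitrary alphabets; the number of distinct characters may grow with $n$). -}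

module Defs where

open import Data.Fin.Base using (Fin; fromℕ<)
import Data.Fin.Properties as Fin
open import Function.Base using (it)
import Data.Integer.Base as ℤ
open import Data.List.Base
  using (List; []; _∷_; _++_; length; map; drop; lookup; replicate; concatMap; allFin; cartesianProduct)
open import Data.List.Extrema using (argmax; f[xs]≤f[argmax])
open import Data.List.Membership.Propositional using (_∈_; lose)
open import Data.List.Membership.Propositional.Properties
  using (∈-concatMap⁺; ∈-cartesianProduct⁺; ∈-allFin; ∈-++⁺ˡ; ∈-++⁺ʳ; ∈-++⁻; ∈-map⁺)
import Data.List.Membership.DecPropositional as DecMembership
open import Data.List.Properties
  using (length-map; length-drop; length-++; length-replicate; drop-map; map-++)
open import Data.List.Relation.Binary.Prefix.Heterogeneous using (Prefix; []; _∷_)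
open import Data.List.Relation.Binary.Prefix.Heterogeneous.Properties using (prefix?; length-mono)
import Data.List.Relation.Unary.All as All
open import Data.List.Relation.Unary.Any using (here; there; index)
open import Data.List.Relation.Unary.Any.Properties using (lookup-index)
open import Data.Nat.Base using (ℕ; zero; suc; _+_; _∸_; _≤_; _<_; z≤n; s≤s; NonZero; >-nonZero⁻¹; ≢-nonZero⁻¹)
open import Data.Nat.Logarithm using (⌊log₂_⌋)
open import Data.Nat.Properties
  using (≤-refl; ≤-reflexive; ≤-trans; ≤-antisym; +-identityʳ; +-suc; +-assoc; +-monoʳ-≤; +-monoˡ-≤;
         m+[n∸m]≡n; m≤m+n; m≤n+m; n∸n≡0; ≡-irrelevant; anyUpTo?)
import Data.Nat.Properties as ℕ
open import Data.Product.Base using (Σ; ∃; ∃-syntax; _×_; _,_; proj₁; proj₂)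
open import Data.Rational.Base as ℚ using (ℚ; 0ℚ)
import Data.Rational.Properties as ℚ
open import Data.Sum.Base using (_⊎_; inj₁; inj₂)
open import Relation.Binary.Bundles using (TotalOrder; DecTotalOrder)
open import Relation.Binary.Definitions using (DecidableEquality)
open import Relation.Binary.PropositionalEquality
  using (_≡_; refl; sym; trans; cong; subst)
open import Relation.Nullary using (¬_; yes; no; contradiction)
open import Relation.Unary using (Pred; Decidable)

module _ {A : Set} where

  infix 4 _≼_

  _≼_ : List A → List A → Set
  _≼_ = Prefix _≡_

  -- w has an occurrence in S starting before position b; the occurrence
  -- may extend to b and beyond.
  OccursBefore : List A → ℕ → List A → Set
  OccursBefore S b w = ∃[ p ] p < b × w ≼ drop p S

  LongestPrefix : Pred (List A) _ → List A → List A → Set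
  LongestPrefix P X F = F ≼ X × P F × (∀ {G} → G ≼ X → P G → length G ≤ length F)

  data IsPhrase (S : List A) (b : ℕ) : List A → Set where
    literal : ∀ {c} → (c ∷ []) ≼ drop b S → ¬ OccursBefore S b (c ∷ []) →
              IsPhrase S b (c ∷ [])
    copy    : ∀ {c F} → (c ∷ []) ≼ drop b S → OccursBefore S b (c ∷ []) →
              LongestPrefix (OccursBefore S b) (drop b S) F →
              IsPhrase S b F

  -- The phrases from position b to the end of S.
  data IsLZFrom (S : List A) (b : ℕ) : List (List A) → Set where
    done : b ≡ length S → IsLZFrom S b []
    next : ∀ {F Fs} → IsPhrase S b F → IsLZFrom S (b + length F) Fs →
           IsLZFrom S b (F ∷ Fs)

  IsLZ : List A → List (List A) → Set
  IsLZ S = IsLZFrom S 0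

  longestPrefix : ∀ {P : Pred (List A) _} → Decidable P → ∀ X →
                  ∃ (LongestPrefix P X) ⊎ (∀ {F} → F ≼ X → ¬ P F)
  longestPrefix P? [] with P? []
  ... | yes p = inj₁ ([] , [] , p , λ { [] _ → z≤n })
  ... | no ¬p = inj₂ λ { [] → ¬p }
  longestPrefix P? (x ∷ xs) with longestPrefix (λ F → P? (x ∷ F)) xs
  ... | inj₁ (F , F≼ , p , max) =
    inj₁ (x ∷ F , refl ∷ F≼ , p , λ { [] _ → z≤n ; (refl ∷ G≼) q → s≤s (max G≼ q) })
  ... | inj₂ none with P? []
  ...   | yes p = inj₁ ([] , [] , p , λ { [] _ → z≤n ; (refl ∷ G≼) q → contradiction q (none G≼) })
  ...   | no ¬p = inj₂ λ { [] → ¬p ; (refl ∷ G≼) → none G≼ }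

  phrase-≼ : ∀ {S b F} → IsPhrase S b F → F ≼ drop b S
  phrase-≼ (literal c≼ _)        = c≼
  phrase-≼ (copy _ _ (F≼ , _ , _)) = F≼

  phrase-nonempty : ∀ {S b F} → IsPhrase S b F → 1 ≤ length F
  phrase-nonempty (literal _ _)               = s≤s z≤n
  phrase-nonempty (copy c≼ occ (_ , _ , max)) = max c≼ occ

  ≼-unique : ∀ {F G X : List A} → F ≼ X → G ≼ X → length F ≡ length G → F ≡ G
  ≼-unique []         []         _  = refl
  ≼-unique (refl ∷ p) (refl ∷ q) eq = cong (_ ∷_) (≼-unique p q (ℕ.suc-injective eq))

  phrase-unique : ∀ {S b F G} → IsPhrase S b F → IsPhrase S b G → F ≡ G
  phrase-unique (literal p _) (literal q _) = ≼-unique p q refl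
  phrase-unique (literal p ¬o) (copy q o _) =
    contradiction (subst (OccursBefore _ _) (≼-unique q p refl) o) ¬o
  phrase-unique (copy p o _) (literal q ¬o) =
    contradiction (subst (OccursBefore _ _) (≼-unique p q refl) o) ¬o
  phrase-unique (copy _ _ (p , o , max)) (copy _ _ (p′ , o′ , max′)) =
    ≼-unique p p′ (≤-antisym (max′ p o) (max p′ o′))

  no-phrase-at-end : ∀ {S b F} → IsPhrase S b F → ¬ b ≡ length S
  no-phrase-at-end {S} ph refl
    with ≤-trans (phrase-nonempty ph)
           (≤-trans (length-mono (phrase-≼ ph))
             (≤-reflexive (trans (length-drop (length S) S) (n∸n≡0 (length S)))))
  ... | ()

  LZFrom-unique : ∀ {S b Fs Gs} → IsLZFrom S b Fs → IsLZFrom S b Gs → Fs ≡ Gs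
  LZFrom-unique (done _)    (done _)    = refl
  LZFrom-unique (done e)    (next ph _) = contradiction e (no-phrase-at-end ph)
  LZFrom-unique (next ph _) (done e)    = contradiction e (no-phrase-at-end ph)
  LZFrom-unique (next ph l) (next ph′ l′) with refl ← phrase-unique ph ph′ =
    cong (_ ∷_) (LZFrom-unique l l′)

module _ {A : Set} (_≟_ : DecidableEquality A) where

  occursBefore? : ∀ S b → Decidable (OccursBefore S b)
  occursBefore? S b w = anyUpTo? (λ p → prefix? _≟_ w (drop p S)) b

  phrase : ∀ S b → b < length S → ∃ (IsPhrase S b)
  phrase S b b<n = go (drop b S) refl
    where
    go : ∀ X → drop b S ≡ X → ∃ (IsPhrase S b)
    go [] eq = contradiction
      (trans (sym (length-drop b S)) (cong length eq))
      λ e → ℕ.<⇒≱ b<n (ℕ.m∸n≡0⇒m≤n e)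
    go (c ∷ X) eq with c≼ ← subst ((c ∷ []) ≼_) (sym eq) (refl ∷ [])
                     | occursBefore? S b (c ∷ [])
    ... | no ¬o = c ∷ [] , literal c≼ ¬o
    ... | yes o with longestPrefix (occursBefore? S b) (drop b S)
    ...   | inj₁ (F , l) = F , copy c≼ o l
    ...   | inj₂ none    = contradiction o (none c≼)

  lzFrom : ∀ S k b → b ≤ length S → length S ≤ b + k → ∃ (IsLZFrom S b)
  lzFrom S zero b b≤n n≤b =
    [] , done (≤-antisym b≤n (≤-trans n≤b (≤-reflexive (+-identityʳ b))))
  lzFrom S (suc k) b b≤n n≤b+k with b ℕ.≟ length S
  ... | yes e = [] , done e
  ... | no b≢n with F , ph ← phrase S b (ℕ.≤∧≢⇒< b≤n b≢n) =
    let Fs , l = lzFrom S k (b + length F) in-range enough in F ∷ Fs , next ph l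
    where
    in-range : b + length F ≤ length S
    in-range = ≤-trans
      (+-monoʳ-≤ b (≤-trans (length-mono (phrase-≼ ph)) (≤-reflexive (length-drop b S))))
      (≤-reflexive (m+[n∸m]≡n b≤n))
    enough : length S ≤ b + length F + k
    enough = ≤-trans n≤b+k (≤-trans
      (+-monoʳ-≤ b (+-monoˡ-≤ k (phrase-nonempty ph)))
      (≤-reflexive (sym (+-assoc b (length F) k))))

  lz : ∀ S → ∃ (IsLZ S)
  lz S = lzFrom S (length S) 0 z≤n ≤-refl

  z : List A → ℕ
  z S = length (proj₁ (lz S))

  z-unique : ∀ {S Fs} → IsLZ S Fs → z S ≡ length Fs
  z-unique l = cong length (LZFrom-unique (proj₂ (lz _)) l)

  z-nonZero : ∀ S → .{{NonZero (length S)}} → NonZero (z S)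
  z-nonZero []          = contradiction refl (≢-nonZero⁻¹ 0)
  z-nonZero S@(_ ∷ _) with lz S
  ... | _ ∷ _ , next _ _ = _

record Deletion (n : ℕ) : Set₁ where
  field
    {Alphabet}    : Set
    _≟_           : DecidableEquality Alphabet
    A B C         : List Alphabet
    length[ABC]≡n : length (A ++ B ++ C) ≡ n

module _ {n} .{{_ : NonZero n}} (d : Deletion n) where
  open Deletion d

  z[ABC]-nonZero : NonZero (z _≟_ (A ++ B ++ C))
  z[ABC]-nonZero =
    z-nonZero _≟_ (A ++ B ++ C) {{subst NonZero (sym length[ABC]≡n) it}}

  ratio : ℚ
  ratio = (ℤ.+ z _≟_ (A ++ C) ℚ./ z _≟_ (A ++ B ++ C)) {{z[ABC]-nonZero}}

IsMaxRatio : ∀ n .{{_ : NonZero n}} → ℚ → Set₁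
IsMaxRatio n r = (Σ (Deletion n) λ d → ratio d ≡ r) × (∀ (d : Deletion n) → ratio d ℚ.≤ r)

-- The maximum in IsMaxRatio exists because renaming letters preserves z,
-- so the alphabet Fin n suffices for strings of length n.

module _ {A : Set} where

  ∈-drop⁻ : ∀ b (S : List A) {x} → x ∈ drop b S → x ∈ S
  ∈-drop⁻ zero    S       i = i
  ∈-drop⁻ (suc b) (_ ∷ S) i = there (∈-drop⁻ b S i)

  ∈-≼ : ∀ {F X : List A} {x} → F ≼ X → x ∈ F → x ∈ X
  ∈-≼ (refl ∷ p) (here e)  = here e
  ∈-≼ (refl ∷ p) (there i) = there (∈-≼ p i)

module _ {A B : Set} (f : A → B) where

  InjectiveOn : List A → Set
  InjectiveOn S = ∀ {x y} → x ∈ S → y ∈ S → f x ≡ f y → x ≡ y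

  map-≼⁺ : ∀ {F X} → F ≼ X → map f F ≼ map f X
  map-≼⁺ []         = []
  map-≼⁺ (refl ∷ p) = refl ∷ map-≼⁺ p

  ≼-map⁻ : ∀ {G} X → G ≼ map f X → ∃[ F ] F ≼ X × G ≡ map f F
  ≼-map⁻ []       []         = [] , [] , refl
  ≼-map⁻ (x ∷ X) []         = [] , [] , refl
  ≼-map⁻ (x ∷ X) (refl ∷ p) with F , F≼ , refl ← ≼-map⁻ X p = x ∷ F , refl ∷ F≼ , refl

  module _ {S : List A} (inj : InjectiveOn S) where

    map-≼⁻ : ∀ F X → (∀ {x} → x ∈ F → x ∈ S) → (∀ {x} → x ∈ X → x ∈ S) →
             map f F ≼ map f X → F ≼ X
    map-≼⁻ []      X       _  _  _       = []
    map-≼⁻ (x ∷ F) (y ∷ X) ⊆F ⊆X (e ∷ p) =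
      inj (⊆F (here refl)) (⊆X (here refl)) e
        ∷ map-≼⁻ F X (λ i → ⊆F (there i)) (λ i → ⊆X (there i)) p

    occurs⁺ : ∀ {b F} → OccursBefore S b F → OccursBefore (map f S) b (map f F)
    occurs⁺ (p , p<b , F≼) = p , p<b , subst (_ ≼_) (sym (drop-map p S)) (map-≼⁺ F≼)

    occurs⁻ : ∀ {b F} → F ≼ drop b S → OccursBefore (map f S) b (map f F) → OccursBefore S b F
    occurs⁻ {b} {F} F≼S (p , p<b , F≼) = p , p<b ,
      map-≼⁻ F (drop p S) (λ i → ∈-drop⁻ b S (∈-≼ F≼S i)) (∈-drop⁻ p S)
        (subst (_ ≼_) (drop-map p S) F≼)

    ≼-drop⁺ : ∀ b {F} → F ≼ drop b S → map f F ≼ drop b (map f S)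
    ≼-drop⁺ b F≼ = subst (_ ≼_) (sym (drop-map b S)) (map-≼⁺ F≼)

    phrase⁺ : ∀ {b F} → IsPhrase S b F → IsPhrase (map f S) b (map f F)
    phrase⁺ {b} (literal c≼ ¬o) = literal (≼-drop⁺ b c≼) (λ o → ¬o (occurs⁻ c≼ o))
    phrase⁺ {b} {F} (copy c≼ o (F≼ , p , max)) =
      copy (≼-drop⁺ b c≼) (occurs⁺ o) (≼-drop⁺ b F≼ , occurs⁺ p , max′)
      where
      max′ : ∀ {G} → G ≼ drop b (map f S) → OccursBefore (map f S) b G → length G ≤ length (map f F)
      max′ G≼ q with G , G≼′ , refl ← ≼-map⁻ (drop b S) (subst (_ ≼_) (drop-map b S) G≼)
        rewrite length-map f G | length-map f F = max G≼′ (occurs⁻ G≼′ q)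

    LZFrom⁺ : ∀ {b Fs} → IsLZFrom S b Fs → IsLZFrom (map f S) b (map (map f) Fs)
    LZFrom⁺ (done e)    = done (trans e (sym (length-map f S)))
    LZFrom⁺ {b} (next {F} ph l) = next (phrase⁺ ph)
      (subst (λ k → IsLZFrom (map f S) (b + k) _) (sym (length-map f F)) (LZFrom⁺ l))

    z-map : (_≟ᴬ_ : DecidableEquality A) (_≟ᴮ_ : DecidableEquality B) →
            z _≟ᴮ_ (map f S) ≡ z _≟ᴬ_ S
    z-map _≟ᴬ_ _≟ᴮ_ = trans (z-unique _≟ᴮ_ (LZFrom⁺ (proj₂ (lz _≟ᴬ_ S)))) (length-map (map f) (proj₁ (lz _≟ᴬ_ S)))

module _ {A : Set} (_≟_ : DecidableEquality A) where

  open DecMembership _≟_ using (_∈?_)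

  letterIndex : ∀ {n} .{{_ : NonZero n}} (S : List A) → length S ≡ n → A → Fin n
  letterIndex S refl c with c ∈? S
  ... | yes i = index i
  ... | no _  = fromℕ< (>-nonZero⁻¹ (length S))

  letterIndex-injective : ∀ {n} .{{_ : NonZero n}} (S : List A) (e : length S ≡ n) →
                          InjectiveOn (letterIndex S e) S
  letterIndex-injective S refl {x} {y} x∈ y∈ eq with x ∈? S | y ∈? S
  ... | no x∉  | _      = contradiction x∈ x∉
  ... | yes _  | no y∉  = contradiction y∈ y∉
  ... | yes i  | yes j  = trans (lookup-index i) (trans (cong (lookup S) eq) (sym (lookup-index j)))

wordsUpTo : ∀ (n k : ℕ) → List (List (Fin n))
wordsUpTo n zero    = [] ∷ []
wordsUpTo n (suc k) = [] ∷ concatMap (λ c → map (c ∷_) (wordsUpTo n k)) (allFin n)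

∈-wordsUpTo : ∀ {n k} (w : List (Fin n)) → length w ≤ k → w ∈ wordsUpTo n k
∈-wordsUpTo {k = zero}  []      _ = here refl
∈-wordsUpTo {k = suc k} []      _ = here refl
∈-wordsUpTo {n} {suc k} (c ∷ w) (s≤s le) =
  there (∈-concatMap⁺ _ (lose (∈-allFin c) (∈-map⁺ (c ∷_) (∈-wordsUpTo w le))))

max-exists : ∀ {a} {D : Set a} (f : D → ℚ) (d₀ : D) (ds : List D) →
             (∀ d → ∃[ d′ ] d′ ∈ ds × f d′ ≡ f d) →
             ∃[ r ] (Σ D λ d → f d ≡ r) × (∀ d → f d ℚ.≤ r)
max-exists f d₀ ds rep = f best , (best , refl) , λ d →
  let d′ , d′∈ , eq = rep d in
  subst (ℚ._≤ f best) eq (All.lookup (f[xs]≤f[argmax] ℚ≤ {f = f} d₀ ds) d′∈)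
  where
  ℚ≤ : TotalOrder _ _ _
  ℚ≤ = DecTotalOrder.totalOrder ℚ.≤-decTotalOrder
  best = argmax ℚ≤ f d₀ ds

module _ (n : ℕ) where

  Triple : Set
  Triple = List (Fin n) × List (Fin n) × List (Fin n)

  deletions : Triple → List (Deletion n)
  deletions (A , B , C) with length (A ++ B ++ C) ℕ.≟ n
  ... | yes e = record { _≟_ = Fin._≟_ ; A = A ; B = B ; C = C ; length[ABC]≡n = e } ∷ []
  ... | no _  = []

  triples : List Triple
  triples = cartesianProduct W (cartesianProduct W W)
    where W = wordsUpTo n n

  finDeletions : List (Deletion n)
  finDeletions = concatMap deletions triples

  ∈-finDeletions : ∀ A B C (e : length (A ++ B ++ C) ≡ n) →
    record { _≟_ = Fin._≟_ ; A = A ; B = B ; C = C ; length[ABC]≡n = e } ∈ finDeletions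
  ∈-finDeletions A B C e = ∈-concatMap⁺ deletions (lose triple∈ del∈)
    where
    len : length A + (length B + length C) ≡ n
    len = trans (sym (trans (length-++ A) (cong (length A +_) (length-++ B)))) e
    A≤ : length A ≤ n
    A≤ = ≤-trans (m≤m+n _ _) (≤-reflexive len)
    BC≤ : length B + length C ≤ n
    BC≤ = ≤-trans (m≤n+m _ (length A)) (≤-reflexive len)
    triple∈ : (A , B , C) ∈ triples
    triple∈ = ∈-cartesianProduct⁺ (∈-wordsUpTo A A≤)
      (∈-cartesianProduct⁺ (∈-wordsUpTo B (≤-trans (m≤m+n _ _) BC≤))
                           (∈-wordsUpTo C (≤-trans (m≤n+m _ (length B)) BC≤)))
    del∈ : record { _≟_ = Fin._≟_ ; A = A ; B = B ; C = C ; length[ABC]≡n = e } ∈ deletions (A , B , C)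
    del∈ with length (A ++ B ++ C) ℕ.≟ n
    ... | yes e′ with refl ← ≡-irrelevant e e′ = here refl
    ... | no ¬e = contradiction e ¬e

  module _ .{{_ : NonZero n}} where

    /-cong : ∀ {p p′ q q′} .{{_ : NonZero q}} .{{_ : NonZero q′}} →
             p ≡ p′ → q ≡ q′ → ℤ.+ p ℚ./ q ≡ ℤ.+ p′ ℚ./ q′
    /-cong refl refl = refl

    relabel : (d : Deletion n) → ∃[ d′ ] d′ ∈ finDeletions × ratio d′ ≡ ratio d
    relabel d = d′ , ∈-finDeletions (map f A) (map f B) (map f C) len ,
      /-cong {{z[ABC]-nonZero d′}} {{z[ABC]-nonZero d}}
        (trans (cong (z Fin._≟_) (sym (map-++ f A C))) (z-map f injAC _≟_ Fin._≟_))
        (trans (cong (z Fin._≟_) (sym map-ABC)) (z-map f inj _≟_ Fin._≟_))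
      where
      open Deletion d
      f = letterIndex _≟_ (A ++ B ++ C) length[ABC]≡n
      inj : InjectiveOn f (A ++ B ++ C)
      inj = letterIndex-injective _≟_ (A ++ B ++ C) length[ABC]≡n
      ⊆ABC : ∀ {x} → x ∈ A ++ C → x ∈ A ++ B ++ C
      ⊆ABC i with ∈-++⁻ A i
      ... | inj₁ a = ∈-++⁺ˡ a
      ... | inj₂ c = ∈-++⁺ʳ A (∈-++⁺ʳ B c)
      injAC : InjectiveOn f (A ++ C)
      injAC i j = inj (⊆ABC i) (⊆ABC j)
      map-ABC : map f (A ++ B ++ C) ≡ map f A ++ map f B ++ map f C
      map-ABC = trans (map-++ f A (B ++ C)) (cong (map f A ++_) (map-++ f B C))
      len : length (map f A ++ map f B ++ map f C) ≡ n
      len = trans (cong length (sym map-ABC)) (trans (length-map f (A ++ B ++ C)) length[ABC]≡n)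
      d′ : Deletion n
      d′ = record { _≟_ = Fin._≟_ ; A = map f A ; B = map f B ; C = map f C ; length[ABC]≡n = len }

    abstract
      maxRatio : ∃ (IsMaxRatio n)
      maxRatio = max-exists ratio start finDeletions relabel
        where
        start : Deletion n
        start = record
          { _≟_ = Fin._≟_ ; A = [] ; B = [] ; C = replicate n (fromℕ< (>-nonZero⁻¹ n))
          ; length[ABC]≡n = length-replicate n }

DSub : ∀ n → .{{NonZero n}} → ℚ
DSub n = proj₁ (maxRatio n)

DSub-isMaxRatio : ∀ n .{{_ : NonZero n}} → IsMaxRatio n (DSub n)
DSub-isMaxRatio n = proj₂ (maxRatio n)

infix 4 _∈Θ_

-- For nonnegative f and g, hence no absolute values.
_∈Θ_ : (f g : ∀ n → .{{NonZero n}} → ℚ) → Set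
f ∈Θ g = ∃[ c₁ ] ∃[ c₂ ] ∃[ N ] 0ℚ ℚ.< c₁ × 0ℚ ℚ.< c₂ ×
  (∀ n .{{_ : NonZero n}} → N ≤ n → c₁ ℚ.* g n ℚ.≤ f n × f n ℚ.≤ c₂ ℚ.* g n)

-- ⌊log₂ n⌋ ≤ log₂ n ≤ 2 ⌊log₂ n⌋ for n ≥ 2, so the integer logarithm has
-- the same Θ-class as the real logarithm to any fixed base.
log : ∀ n → .{{NonZero n}} → ℚ
log n = ℤ.+ ⌊log₂ n ⌋ ℚ./ 1

{-# OPTIONS --safe #-}

-- Upper bound. Let p be the start of a non-final phrase of AC with length in
-- [h , 2h). The window of length 2h at p has no earlier occurrence, so neither
-- do the windows of length 3h at p ∸ j for j < h. Such a window crosses the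
-- end of A or occurs in ABC, where it has an occurrence that contains the end of
-- a phrase, at one of 3h offsets. The position of that occurrence determines
-- the window, so there are O(z(ABC)) phrases of AC for each power of two h.
--
-- Lower bound. Let D = 2 ^ k and let row s consist of the letters (t , t < s),
-- for t in bit-reversed order. Successive rows differ in one letter, so that
-- B = row 0 ⋯ row D followed by any D rows has O(D) phrases. Let C list the rows
-- by recursive bisection of the times s. When the midpoint of a time interval
-- of length 2h is reached, the rows seen so far lie outside its interior, and
-- bit reversal spreads the letters that flip in its first and in its second half
-- alternately. That yields h disjoint substrings that are new in C, hence
-- k D / 2 phrases in total.

module Submission where

open import Defs

open import Data.Bool.Base using (Bool; true; T)
import Data.Bool.Properties as Bool
import Data.Integer.Base as ℤ
import Data.Integer.Properties as ℤ
open import Data.List.Base using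
  (List; []; _∷_; _++_; length; map; drop; take; concatMap; cartesianProduct; upTo; replicate; iterate)
open import Data.List.Properties
open import Data.List.Membership.Propositional using (_∈_)
open import Data.List.Membership.Propositional.Properties
open import Data.List.Relation.Binary.Prefix.Heterogeneous using ([]; _∷_)
import Data.List.Relation.Binary.Prefix.Heterogeneous.Properties as Prefix
open import Data.List.Relation.Binary.Sublist.Propositional using (_⊆_; []; _∷_; _∷ʳ_; ⊆-trans; ⊆-reflexive; lookup)
import Data.List.Relation.Binary.Sublist.Propositional.Properties as Sublist
open import Data.List.Relation.Unary.All as All using (All; []; _∷_)
open import Data.List.Relation.Unary.All.Properties using (++⁺)
open import Data.List.Relation.Unary.AllPairs as AllPairs using (AllPairs; []; _∷_)
open import Data.List.Relation.Unary.Any using (here; there)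
open import Data.List.Relation.Unary.Unique.Propositional using (Unique)
open import Data.List.Relation.Unary.Unique.Propositional.Properties using (cartesianProduct⁺; upTo⁺)
open import Data.Maybe.Base using (Maybe; just; nothing)
open import Data.Nat.Base
open import Data.Nat.Induction using (<-wellFounded)
open import Data.Nat.Logarithm
open import Data.Nat.Properties
open import Data.Nat.Tactic.RingSolver using (solve-∀)
open import Data.Product.Base using (∃-syntax; _×_; _,_; proj₁; proj₂)
import Data.Product.Properties as Product
open import Data.Rational.Base as ℚ using (0ℚ)
import Data.Rational.Properties as ℚ
open import Data.Rational.Unnormalised.Base as ℚᵘ using (mkℚᵘ)
import Data.Rational.Unnormalised.Properties as ℚᵘ
import Data.Sum.Base as Sum
open import Data.Sum.Base using (_⊎_; inj₁; inj₂)
open import Function.Base using (_∘_)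
open import Induction.WellFounded using (Acc; acc)
open import Relation.Binary.Definitions using (DecidableEquality; tri<; tri≈; tri>)
open import Relation.Binary.PropositionalEquality
import Relation.Binary.Reasoning.Setoid as ≈-Reasoning
open import Relation.Nullary using (¬_; Dec; yes; no; contradiction)
open import Relation.Nullary.Decidable using (dec-true; dec-false; toWitness)

-- LZ factorizations

module _ {A : Set} where

  ≼-trans : ∀ {X Y Z : List A} → X ≼ Y → Y ≼ Z → X ≼ Z
  ≼-trans = Prefix.trans trans

  ≼-++ : ∀ (X Y : List A) → X ≼ X ++ Y
  ≼-++ []      Y = []
  ≼-++ (_ ∷ X) Y = refl ∷ ≼-++ X Y

  take-≼ : ∀ n (X : List A) → take n X ≼ X
  take-≼ n X = subst (take n X ≼_) (take++drop≡id n X) (≼-++ (take n X) (drop n X))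

  ≼-comparable : ∀ {F G X : List A} → F ≼ X → G ≼ X → length F ≤ length G → F ≼ G
  ≼-comparable []         _          _        = []
  ≼-comparable (refl ∷ p) (refl ∷ q) (s≤s le) = refl ∷ ≼-comparable p q le

  ≼-drop : ∀ {w : List A} b j S → w ≼ drop b S → drop j w ≼ drop (b + j) S
  ≼-drop b j S p = subst (_ ≼_) (drop-drop b j S) (Prefix.drop⁺ j p)

  ≼-transport : ∀ {F w : List A} S b p j → F ≼ drop b S → F ≼ drop p S →
                w ≼ drop (b + j) S → j + length w ≤ length F → w ≼ drop (p + j) S
  ≼-transport {F} {w} S b p j F≼b F≼p w≼ le =
    ≼-trans (≼-comparable w≼ (≼-drop b j S F≼b) short) (≼-drop p j S F≼p)
    where
    short : length w ≤ length (drop j F)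
    short = subst (length w ≤_) (sym (length-drop j F))
      (m+n≤o⇒m≤o∸n (length w) (subst (_≤ length F) (+-comm j (length w)) le))

  module _ {S : List A} where

    -- Literals are covered too: an earlier occurrence of a nonempty `w` would be one of its first
    -- letter.
    phrase-maximal : ∀ {b F w} → IsPhrase S b F → w ≼ drop b S → OccursBefore S b w →
                     length w ≤ length F
    phrase-maximal {w = []} _ _ _ = z≤n
    phrase-maximal {w = c ∷ w} (literal c≼ ¬o) w≼ (p , p<b , w≼p) =
      contradiction (p , p<b , ≼-trans (≼-comparable c≼ w≼ (s≤s z≤n)) w≼p) ¬o
    phrase-maximal (copy _ _ (_ , _ , max)) w≼ o = max w≼ o

    -- At least one letter of the phrase follows `w`. As `w` is nonempty, this rules out a literal,
    -- and the source of the copy contains `w` at the same offset.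
    phrase-interior : ∀ {b F w j} → IsPhrase S b F → w ≼ drop (b + j) S → 1 ≤ length w →
                      j + length w < length F → ∃[ p ] p < b × w ≼ drop (p + j) S
    phrase-interior {w = w} {j} (literal _ _) w≼ 1≤w (s≤s le) =
      contradiction (≤-trans 1≤w (≤-trans (m≤n+m (length w) j) le)) 1+n≰n
    phrase-interior {b} {j = j} (copy _ _ (F≼ , (p , p<b , F≼p) , _)) w≼ 1≤w lt =
      p , p<b , ≼-transport S b p j F≼ F≼p w≼ (<⇒≤ lt)

    -- A relaxed LZ factorization: pieces need not be longest and may be empty, and a single letter
    -- is allowed whether or not it is new.
    data Factorization (b : ℕ) : ℕ → Set where
      end   : b ≡ length S → Factorization b 0
      piece : ∀ {F m} → F ≼ drop b S → length F ≤ 1 ⊎ OccursBefore S b F →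
              Factorization (b + length F) m → Factorization b (suc m)

    -- Nonemptiness rules out positions past the end, where `drop b S` is empty.
    ≼-fits : ∀ {b w} → w ≼ drop b S → 1 ≤ length w → b + length w ≤ length S
    ≼-fits {b} {w} w≼ 1≤w = subst (b + length w ≤_) (m+[n∸m]≡n b≤) (+-monoʳ-≤ b w≤)
      where
      w≤ : length w ≤ length S ∸ b
      w≤ = ≤-trans (Prefix.length-mono w≼) (≤-reflexive (length-drop b S))
      b≤ : b ≤ length S
      b≤ = <⇒≤ (m∸n≢0⇒n<m λ e → contradiction (≤-trans 1≤w (≤-trans w≤ (≤-reflexive e))) λ ())

    -- Greedy phrases stay ahead of the pieces of any other factorization.
    LZ-optimal : ∀ {b b′ m Fs} → Factorization b m → b ≤ b′ → IsLZFrom S b′ Fs → length Fs ≤ m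
    LZ-optimal f b≤ (done _) = z≤n
    LZ-optimal {b′ = b′} (end refl) b≤ (next {G} ph _) =
      contradiction (≤-antisym (≤-trans (m≤m+n b′ (length G))
        (≼-fits (phrase-≼ ph) (phrase-nonempty ph))) b≤) (no-phrase-at-end ph)
    LZ-optimal {b} {b′} (piece {F} F≼ src f) b≤ l@(next {G} ph l′) with b + length F ≤? b′
    ... | yes passed = m≤n⇒m≤1+n (LZ-optimal f passed l)
    ... | no  inside with j , refl ← m≤n⇒∃[o]m+o≡n b≤ = s≤s (LZ-optimal f (reach src) l′)
      where
      j<F : j < length F
      j<F = +-cancelˡ-< b j (length F) (≰⇒> inside)
      -- If `F` has a source at `p`, its rest `drop j F` occurs at `p + j`, so the greedy phrase
      -- starting at `b + j` is at least as long as that rest.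
      reach : length F ≤ 1 ⊎ OccursBefore S b F → b + length F ≤ b + j + length G
      reach (inj₁ F≤1) = ≤-trans (+-monoʳ-≤ b (≤-trans F≤1 (phrase-nonempty ph)))
                                 (+-monoˡ-≤ (length G) (m≤m+n b j))
      reach (inj₂ (p , p<b , F≼p)) = subst (b + length F ≤_) (sym (+-assoc b j (length G)))
        (+-monoʳ-≤ b (≤-trans (m≤n+m∸n (length F) j) (+-monoʳ-≤ j tail≤G)))
        where
        tail≤G : length F ∸ j ≤ length G
        tail≤G = subst (_≤ length G) (length-drop j F)
          (phrase-maximal ph (≼-drop b j S F≼) (p + j , +-monoˡ-< j p<b , ≼-drop p j S F≼p))

    -- The first index only bounds the first start from below, so gaps between the windows are
    -- allowed.
    data NewWindows (b : ℕ) : ℕ → Set where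
      none   : NewWindows b 0
      window : ∀ {l w m} → b ≤ l → 1 ≤ length w → w ≼ drop l S → ¬ OccursBefore S l w →
               NewWindows (l + length w) m → NewWindows b (suc m)

    NewWindows-weaken : ∀ {b b′ m} → b ≤ b′ → NewWindows b′ m → NewWindows b m
    NewWindows-weaken _    none = none
    NewWindows-weaken b≤b′ (window b′≤l 1≤w w≼ new ws) = window (≤-trans b≤b′ b′≤l) 1≤w w≼ new ws

    -- A phrase cannot extend beyond a substring that is new, so disjoint
    -- new substrings contain ends of distinct phrases.
    NewWindows-≤ : ∀ {b m Fs} → IsLZFrom S b Fs → NewWindows b m → m ≤ length Fs
    NewWindows-≤ _ none = z≤n
    NewWindows-≤ (done refl) (window {l} {w} b≤l 1≤w w≼ _ _) =
      contradiction (≤-trans (+-monoʳ-≤ l 1≤w) (≤-trans (≼-fits w≼ 1≤w) b≤l)) (m+1+n≰m l)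
    NewWindows-≤ {b} (next {F} ph lz′) (window {l} {w} b≤l 1≤w w≼ new ws′) with b + length F ≤? l
    ... | yes F≤l = m≤n⇒m≤1+n (NewWindows-≤ lz′ (window F≤l 1≤w w≼ new ws′))
    ... | no F≰l with j , refl ← m≤n⇒∃[o]m+o≡n b≤l = s≤s (NewWindows-≤ lz′ (NewWindows-weaken covered ws′))
      where
      covered : b + length F ≤ b + j + length w
      covered = ≮⇒≥ λ lt →
        let p , p<b , w≼p = phrase-interior ph w≼ 1≤w
              (+-cancelˡ-< b (j + length w) (length F) (subst (_< b + length F) (+-assoc b j (length w)) lt))
        in new (p + j , +-monoˡ-< j p<b , w≼p)

    -- Exclusive ends: an entry is the position just after a phrase.
    ends : ℕ → List (List A) → List ℕ
    ends b []       = []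
    ends b (F ∷ Fs) = b + length F ∷ ends (b + length F) Fs

    length-ends : ∀ b Fs → length (ends b Fs) ≡ length Fs
    length-ends b []       = refl
    length-ends b (F ∷ Fs) = cong suc (length-ends (b + length F) Fs)

    phrase-at : ∀ {b y Fs} → IsLZFrom S b Fs → b ≤ y → y < length S →
                ∃[ b′ ] ∃[ F ] IsPhrase S b′ F × b′ ≤ y × y < b′ + length F × b′ + length F ∈ ends b Fs
    phrase-at (done refl) b≤y y< = contradiction b≤y (<⇒≱ y<)
    phrase-at {b} {y} (next {F} ph l) b≤y y< with b + length F ≤? y
    ... | no ≰y = b , F , ph , b≤y , ≰⇒> ≰y , here refl
    ... | yes ≤y with b′ , F′ , ph′ , b′≤ , <b′ , ∈ends ← phrase-at l ≤y y< =
      b′ , F′ , ph′ , b′≤ , <b′ , there ∈ends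

    -- Following copy phrases back to their sources ends at an occurrence
    -- of w that contains the last letter of a phrase.
    anchored-occurrence : ∀ {w Fs} → IsLZ S Fs → 1 ≤ length w → ∀ y → w ≼ drop y S →
      ∃[ y′ ] ∃[ e ] e ∈ ends 0 Fs × y′ < e × e ≤ y′ + length w × w ≼ drop y′ S
    anchored-occurrence {w} {Fs} lz 1≤w y = go y (<-wellFounded y)
      where
      go : ∀ y → Acc _<_ y → w ≼ drop y S →
           ∃[ y′ ] ∃[ e ] e ∈ ends 0 Fs × y′ < e × e ≤ y′ + length w × w ≼ drop y′ S
      go y (acc rec) w≼
        with b , F , ph , b≤y , y<e , e∈ ← phrase-at lz z≤n
               (≤-trans (m<m+n y 1≤w) (≼-fits {y} w≼ 1≤w))
        with b + length F ≤? y + length w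
      ... | yes e≤ = y , b + length F , e∈ , y<e , e≤ , w≼
      ... | no  e≰ with j , refl ← m≤n⇒∃[o]m+o≡n b≤y =
        let p , p<b , w≼p = phrase-interior ph w≼ 1≤w
              (+-cancelˡ-< b (j + length w) (length F)
                (subst (_< b + length F) (+-assoc b j (length w)) (≰⇒> e≰)))
        in go (p + j) (rec (+-monoˡ-< j p<b)) w≼p

-- Upper bound

length-cartesianProduct : ∀ {A B : Set} (xs : List A) (ys : List B) →
                          length (cartesianProduct xs ys) ≡ length xs * length ys
length-cartesianProduct []       ys = refl
length-cartesianProduct (x ∷ xs) ys = trans (length-++ (map (x ,_) ys))
  (cong₂ _+_ (length-map (x ,_) ys) (length-cartesianProduct xs ys))

-- The `y` related to the head is removed from `ys`; by injectivity the rest of `xs` still has its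
-- images there. With a relation, no code has to be chosen canonically.
pigeonhole : ∀ {A B : Set} (R : A → B → Set) {xs : List A} {ys : List B} → Unique xs →
             (∀ {x} → x ∈ xs → ∃[ y ] y ∈ ys × R x y) →
             (∀ {x x′ y} → x ∈ xs → x′ ∈ xs → R x y → R x′ y → x ≡ x′) →
             length xs ≤ length ys
pigeonhole R {[]} _ _ _ = z≤n
pigeonhole R {x ∷ xs} (x∉ ∷ uniq) image inj
  with y , y∈ , Rxy ← image (here refl)
  with as , bs , refl ← ∈-∃++ y∈ =
  subst (suc (length xs) ≤_)
    (trans (cong suc (length-++ as)) (trans (sym (+-suc (length as) (length bs))) (sym (length-++ as))))
    (s≤s (pigeonhole R uniq image′ (λ i j → inj (there i) (there j))))
  where
  image′ : ∀ {x′} → x′ ∈ xs → ∃[ y′ ] y′ ∈ as ++ bs × R x′ y′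
  image′ i with y′ , y′∈ , Rx′y′ ← image (there i) with ∈-++⁻ as y′∈
  ... | inj₁ a         = y′ , ∈-++⁺ˡ a , Rx′y′
  ... | inj₂ (there b) = y′ , ∈-++⁺ʳ as b , Rx′y′
  ... | inj₂ (here refl) =
    contradiction (inj (here refl) (there i) Rxy Rx′y′) (All.lookup x∉ i)

-- Fresh windows

module _ {A : Set} where

  drop-++-≤ : ∀ q (X Y : List A) → q ≤ length X → drop q (X ++ Y) ≡ drop q X ++ Y
  drop-++-≤ zero    X       Y _        = refl
  drop-++-≤ (suc q) (_ ∷ X) Y (s≤s le) = drop-++-≤ q X Y le

  drop-++-+ : ∀ (X Y : List A) r → drop (length X + r) (X ++ Y) ≡ drop r Y
  drop-++-+ []      Y r = refl
  drop-++-+ (_ ∷ X) Y r = drop-++-+ X Y r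

  windowAt : ℕ → List A → ℕ → List A
  windowAt m S q = take m (drop q S)

  length-windowAt : ∀ m S q → length (windowAt m S q) ≡ m ⊓ (length S ∸ q)
  length-windowAt m S q = trans (length-take m (drop q S)) (cong (m ⊓_) (length-drop q S))

  Fresh : ℕ → List A → ℕ → Set
  Fresh m S q = ¬ OccursBefore S q (windowAt m S q)

  -- Windows truncated by the end of S are harmless: the window at the later
  -- position is at most as long, hence a prefix of the other one.
  fresh-≮ : ∀ {m S X p q} → Fresh m S q → windowAt m S p ≼ X → windowAt m S q ≼ X → ¬ p < q
  fresh-≮ {m} {S} {p = p} {q} fq p≼ q≼ p<q = fq (p , p<q ,
    ≼-trans (≼-comparable q≼ p≼ (subst₂ _≤_ (sym (length-windowAt m S q)) (sym (length-windowAt m S p))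
              (⊓-monoʳ-≤ m (∸-monoʳ-≤ (length S) (<⇒≤ p<q)))))
            (take-≼ m (drop p S)))

  fresh-injective : ∀ {m S X q q′} → Fresh m S q → Fresh m S q′ →
                    windowAt m S q ≼ X → windowAt m S q′ ≼ X → q ≡ q′
  fresh-injective {m} {S} {X} {q} {q′} fq fq′ q≼ q′≼ with <-cmp q q′
  ... | tri< lt _ _ = contradiction lt (fresh-≮ fq′ q≼ q′≼)
  ... | tri≈ _ eq _ = eq
  ... | tri> _ _ gt = contradiction gt (fresh-≮ fq q′≼ q≼)

  module _ (X Y Z : List A) where

    -- Inserting `Y` breaks only windows that cross the end of `X`; the others keep their position
    -- or move right by `length Y`.
    window-in-whole : ∀ m q → q + m ≤ length X ⊎ length X ≤ q →
                      ∃[ y ] windowAt m (X ++ Z) q ≼ drop y (X ++ Y ++ Z)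
    window-in-whole m q (inj₁ q+m≤) = q , subst (windowAt m (X ++ Z) q ≼_)
        (sym (drop-++-≤ q X (Y ++ Z) q≤))
        (≼-trans (≼-comparable
          (subst (windowAt m (X ++ Z) q ≼_) (drop-++-≤ q X Z q≤) (take-≼ m _))
          (≼-++ (drop q X) Z) short) (≼-++ (drop q X) (Y ++ Z)))
      where
      q≤ : q ≤ length X
      q≤ = ≤-trans (m≤m+n q m) q+m≤
      short : length (windowAt m (X ++ Z) q) ≤ length (drop q X)
      short = subst₂ _≤_ (sym (length-windowAt m (X ++ Z) q)) (sym (length-drop q X))
        (≤-trans (m⊓n≤m m _) (m+n≤o⇒m≤o∸n m (subst (_≤ length X) (+-comm q m) q+m≤)))
    window-in-whole m q (inj₂ X≤q) with r , refl ← m≤n⇒∃[o]m+o≡n X≤q =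
      length X + (length Y + r) ,
      subst (windowAt m (X ++ Z) (length X + r) ≼_)
        (trans (drop-++-+ X Z r) (sym (trans (drop-++-+ X (Y ++ Z) (length Y + r)) (drop-++-+ Y Z r))))
        (take-≼ m _)

    -- A fresh window of X ++ Z either crosses the end of X or occurs in
    -- X ++ Y ++ Z, and then it has an occurrence there that contains the
    -- last letter of a phrase. Its offset to that point is less than m.
    fresh-count : ∀ {I : Set} {m Fs} (pos : I → ℕ) {is : List I} → IsLZ (X ++ Y ++ Z) Fs → 1 ≤ m →
      Unique is →
      (∀ {i j} → i ∈ is → j ∈ is → pos i ≡ pos j → i ≡ j) →
      (∀ {i} → i ∈ is → pos i < length (X ++ Z) × Fresh m (X ++ Z) (pos i)) →
      length is ≤ suc (length Fs) * m
    fresh-count {I} {m} {Fs} pos {is} lz 1≤m uniq pos-inj fresh =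
      subst (length is ≤_) len (pigeonhole Code uniq code code-inj)
      where
      S = X ++ Z
      XYZ = X ++ Y ++ Z
      -- `nothing` stands for the end of `X`, where the offset gives the position itself. `just e`
      -- stands for a phrase end, where the offset gives the text of the window and, by freshness,
      -- its position.
      anchors : List (Maybe ℕ)
      anchors = nothing ∷ map just (ends {S = XYZ} 0 Fs)
      len : length (cartesianProduct anchors (upTo m)) ≡ suc (length Fs) * m
      len = trans (length-cartesianProduct anchors (upTo m)) (cong₂ _*_
        (cong suc (trans (length-map just (ends {S = XYZ} 0 Fs)) (length-ends {S = XYZ} 0 Fs))) (length-upTo m))
      Code : I → Maybe ℕ × ℕ → Set
      Code i (nothing , o) = pos i + suc o ≡ length X
      Code i (just e , o)  = windowAt m S (pos i) ≼ drop (e ∸ suc o) XYZ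
      code-inj : ∀ {i j c} → i ∈ is → j ∈ is → Code i c → Code j c → i ≡ j
      code-inj {c = nothing , o} i∈ j∈ ei ej = pos-inj i∈ j∈ (+-cancelʳ-≡ (suc o) _ _ (trans ei (sym ej)))
      code-inj {c = just e , o} i∈ j∈ pi pj =
        pos-inj i∈ j∈ (fresh-injective {m} {S} (proj₂ (fresh i∈)) (proj₂ (fresh j∈)) pi pj)
      inside : ∀ {i} → i ∈ is → (pos i + m ≤ length X ⊎ length X ≤ pos i) →
               ∃[ c ] c ∈ cartesianProduct anchors (upTo m) × Code i c
      inside {i} i∈ where?
        with y , w≼ ← window-in-whole m (pos i) where?
        with y′ , e , e∈ , y′<e , e≤ , w≼′ ← anchored-occurrence lz
               (subst (1 ≤_) (sym (length-windowAt m S (pos i)))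
                 (⊓-glb 1≤m (m<n⇒0<n∸m (proj₁ (fresh i∈))))) y w≼
        with o , refl ← m≤n⇒∃[o]m+o≡n y′<e =
        (just (suc y′ + o) , o) ,
        ∈-cartesianProduct⁺ (there (∈-map⁺ just e∈)) (∈-upTo⁺ o<m) ,
        subst (λ y → windowAt m S (pos i) ≼ drop y XYZ) (sym back) w≼′
        where
        back : suc y′ + o ∸ suc o ≡ y′
        back = trans (cong (_∸ suc o) (sym (+-suc y′ o))) (m+n∸n≡m y′ (suc o))
        o<m : o < m
        o<m = ≤-trans (+-cancelˡ-≤ y′ (suc o) _ (subst (_≤ y′ + length (windowAt m S (pos i))) (sym (+-suc y′ o)) e≤))
          (subst (_≤ m) (sym (length-windowAt m S (pos i))) (m⊓n≤m m _))
      code : ∀ {i} → i ∈ is → ∃[ c ] c ∈ cartesianProduct anchors (upTo m) × Code i c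
      code {i} i∈ with pos i + m ≤? length X | length X ≤? pos i
      ... | yes le | _      = inside i∈ (inj₁ le)
      ... | no _   | yes le = inside i∈ (inj₂ le)
      ... | no ¬le | no ¬ge with o , eq ← m≤n⇒∃[o]m+o≡n (≰⇒> ¬ge) =
        (nothing , o) , ∈-cartesianProduct⁺ {xs = anchors} (here refl) (∈-upTo⁺ o<m) , e
        where
        e : pos i + suc o ≡ length X
        e = trans (+-suc (pos i) o) eq
        o<m : o < m
        o<m = <⇒≤ (+-cancelˡ-< (pos i) _ _ (subst (_< pos i + m) (sym e) (≰⇒> ¬le)))

-- Binary logarithms and finite sums

n<2^[1+k]⇒⌊log₂n⌋≤k : ∀ k n → n < 2 ^ suc k → ⌊log₂ n ⌋ ≤ k
n<2^[1+k]⇒⌊log₂n⌋≤k zero    zero          _             = z≤n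
n<2^[1+k]⇒⌊log₂n⌋≤k zero    (suc zero)    _             = z≤n
n<2^[1+k]⇒⌊log₂n⌋≤k zero    (suc (suc n)) (s≤s (s≤s ()))
n<2^[1+k]⇒⌊log₂n⌋≤k (suc k) n             n< =
  ≤-trans (m≤n+m∸n ⌊log₂ n ⌋ 1) (s≤s (subst (_≤ k) (⌊log₂⌊n/2⌋⌋≡⌊log₂n⌋∸1 n)
    (n<2^[1+k]⇒⌊log₂n⌋≤k k ⌊ n /2⌋ half<)))
  where
  half< : ⌊ n /2⌋ < 2 ^ suc k
  half< = *-cancelˡ-< 2 ⌊ n /2⌋ (2 ^ suc k) (≤-<-trans
    (subst₂ _≤_ (cong (⌊ n /2⌋ +_) (sym (+-identityʳ ⌊ n /2⌋))) (⌊n/2⌋+⌈n/2⌉≡n n)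
      (+-monoʳ-≤ ⌊ n /2⌋ (⌊n/2⌋≤⌈n/2⌉ n))) n<)

n<2^[1+⌊log₂n⌋] : ∀ n → n < 2 ^ suc ⌊log₂ n ⌋
n<2^[1+⌊log₂n⌋] n = ≰⇒> λ ≤n → 1+n≰n
  (subst (_≤ ⌊log₂ n ⌋) (⌊log₂[2^n]⌋≡n (suc ⌊log₂ n ⌋)) (⌊log₂⌋-mono-≤ ≤n))

2^⌊log₂n⌋≤n : ∀ n → 1 ≤ n → 2 ^ ⌊log₂ n ⌋ ≤ n
2^⌊log₂n⌋≤n n 1≤n with ⌊log₂ n ⌋ in eq
... | zero  = 1≤n
... | suc k = ≮⇒≥ λ n< → 1+n≰n (subst (_≤ k) eq (n<2^[1+k]⇒⌊log₂n⌋≤k k n n<))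

sumTo : ℕ → (ℕ → ℕ) → ℕ
sumTo zero    f = 0
sumTo (suc K) f = f K + sumTo K f

sumTo-mono : ∀ K {f g} → (∀ k → f k ≤ g k) → sumTo K f ≤ sumTo K g
sumTo-mono zero    f≤g = z≤n
sumTo-mono (suc K) f≤g = +-mono-≤ (f≤g K) (sumTo-mono K f≤g)

sumTo-strict : ∀ K {f g} i → i < K → (∀ k → f k ≤ g k) → f i < g i → sumTo K f < sumTo K g
sumTo-strict (suc K) i i<1+K f≤g fi<gi with i ≟ K
... | yes refl = +-mono-<-≤ fi<gi (sumTo-mono K f≤g)
... | no  i≢K  = +-mono-≤-< (f≤g K) (sumTo-strict K i (≤∧≢⇒< (s≤s⁻¹ i<1+K) i≢K) f≤g fi<gi)

sumTo-≤-* : ∀ K {f c} → (∀ k → f k ≤ c) → sumTo K f ≤ K * c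
sumTo-≤-* zero    f≤c = z≤n
sumTo-≤-* (suc K) f≤c = +-mono-≤ (f≤c K) (sumTo-≤-* K f≤c)

AllPairs-compare : ∀ {A : Set} {R : A → A → Set} {xs x y} → AllPairs R xs → x ∈ xs → y ∈ xs →
                   x ≡ y ⊎ R x y ⊎ R y x
AllPairs-compare (_ ∷ _)  (here refl) (here refl) = inj₁ refl
AllPairs-compare (r ∷ _)  (here refl) (there j)   = inj₂ (inj₁ (All.lookup r j))
AllPairs-compare (r ∷ _)  (there i)   (here refl) = inj₂ (inj₂ (All.lookup r i))
AllPairs-compare (_ ∷ rs) (there i)   (there j)   = AllPairs-compare rs i j

-- Phrases grouped by the logarithm of their length

Spaced : ℕ → List ℕ → Set
Spaced h = AllPairs (λ p q → p + h ≤ q)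

consIf : ∀ {A P : Set} → Dec P → A → List A → List A
consIf (yes _) x xs = x ∷ xs
consIf (no _)  x xs = xs

module _ {A : Set} where

  -- The last phrase is left out: it may end with the string instead of at
  -- a mismatch, and then no window at its start needs to be fresh.
  classStarts : ℕ → ℕ → List (List A) → List ℕ
  classStarts k b []               = []
  classStarts k b (F ∷ [])         = []
  classStarts k b (F ∷ Fs@(_ ∷ _)) =
    consIf (⌊log₂ length F ⌋ ≟ k) b (classStarts k (b + length F) Fs)

  module _ {S : List A} where

    -- A phrase of class `k` has length at least `2 ^ k`, and all later starts lie beyond its end.
    classStarts-spaced : ∀ k {b Fs} → IsLZFrom S b Fs →
      All (b ≤_) (classStarts k b Fs) × Spaced (2 ^ k) (classStarts k b Fs)
    classStarts-spaced k (done _)                = [] , []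
    classStarts-spaced k (next _ (done _))       = [] , []
    classStarts-spaced k {b} (next {F} ph l@(next _ _))
      with later , spaced ← classStarts-spaced k l | ⌊log₂ length F ⌋ ≟ k
    ... | yes refl = ≤-refl ∷ All.map (≤-trans (m≤m+n b (length F))) later ,
                     All.map (≤-trans (+-monoʳ-≤ b (2^⌊log₂n⌋≤n (length F) (phrase-nonempty ph)))) later ∷ spaced
    ... | no _     = All.map (≤-trans (m≤m+n b (length F))) later , spaced

    phrase-fits : ∀ {b F} → IsPhrase S b F → b + length F ≤ length S
    phrase-fits {b} ph = ≼-fits {b = b} (phrase-≼ ph) (phrase-nonempty ph)

    phrase-start : ∀ {b F} → IsPhrase S b F → b < length S
    phrase-start {b} ph = ≤-trans (m<m+n b (phrase-nonempty ph)) (phrase-fits ph)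

    -- The window is longer than the phrase at its start, even if the end of `S` truncates it,
    -- because another phrase follows. An earlier occurrence would contradict the maximality of the
    -- phrase.
    classStarts-fresh : ∀ k {b Fs} → IsLZFrom S b Fs →
      All (λ p → p < length S × Fresh (2 ^ suc k) S p) (classStarts k b Fs)
    classStarts-fresh k (done _)          = []
    classStarts-fresh k (next _ (done _)) = []
    classStarts-fresh k {b} (next {F} ph l@(next ph′ _)) with classStarts-fresh k l | ⌊log₂ length F ⌋ ≟ k
    ... | rest | no _     = rest
    ... | rest | yes refl = (phrase-start ph , λ o → <⇒≱ longer (phrase-maximal ph (take-≼ _ _) o)) ∷ rest
      where
      longer : length F < length (windowAt (2 ^ suc k) S b)
      longer = subst (length F <_) (sym (length-windowAt (2 ^ suc k) S b))
        (⊓-glb (n<2^[1+⌊log₂n⌋] (length F))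
               (m+n≤o⇒m≤o∸n (suc (length F)) (subst (_≤ length S) (cong suc (+-comm b (length F))) (phrase-start ph′))))

    -- Each phrase but the last raises the count of its own class and lowers no other; the outer
    -- `suc` accounts for the last phrase.
    length≤classes : ∀ {b Fs} K → IsLZFrom S b Fs → ⌊log₂ length S ⌋ < K →
      length Fs ≤ suc (sumTo K (λ k → length (classStarts k b Fs)))
    length≤classes K (done _)          _ = z≤n
    length≤classes K (next _ (done _)) _ = s≤s z≤n
    length≤classes {b} K (next {F} {Fs} ph l@(next _ _)) log<K =
      s≤s (≤-trans (length≤classes K l log<K) (sumTo-strict K ⌊log₂ length F ⌋ small mono strict))
      where
      small : ⌊log₂ length F ⌋ < K
      small = ≤-<-trans (⌊log₂⌋-mono-≤ (≤-trans (m≤n+m (length F) b) (phrase-fits ph))) log<K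
      mono : ∀ k → length (classStarts k (b + length F) Fs) ≤ length (classStarts k b (F ∷ Fs))
      mono k with ⌊log₂ length F ⌋ ≟ k
      ... | yes _ = n≤1+n _
      ... | no  _ = ≤-refl
      strict : length (classStarts ⌊log₂ length F ⌋ (b + length F) Fs) <
               length (classStarts ⌊log₂ length F ⌋ b (F ∷ Fs))
      strict with ⌊log₂ length F ⌋ ≟ ⌊log₂ length F ⌋
      ... | yes _ = ≤-refl
      ... | no ¬e = contradiction refl ¬e

    -- Since `j < h`, the longer window contains the shorter one at offset `j`, so an earlier
    -- occurrence of the former would give one of the latter.
    fresh-extend : ∀ h p j → j < h → j ≤ p → p ≤ length S → Fresh (2 * h) S p → Fresh (3 * h) S (p ∸ j)
    fresh-extend h p j j<h j≤p p≤ fresh (x , x< , occ) = fresh (x + j , x+j<p ,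
      ≼-trans (≼-comparable (take-≼ (2 * h) (drop p S)) tail≼ short) (≼-drop x j S occ))
      where
      w = windowAt (3 * h) S (p ∸ j)
      back : p ∸ j + j ≡ p
      back = m∸n+n≡m j≤p
      x+j<p : x + j < p
      x+j<p = subst (x + j <_) back (+-monoˡ-< j x<)
      tail≼ : drop j w ≼ drop p S
      tail≼ = subst (λ y → drop j w ≼ drop y S) back (≼-drop (p ∸ j) j S (take-≼ (3 * h) _))
      short : length (windowAt (2 * h) S p) ≤ length (drop j w)
      short = subst₂ _≤_ (sym (length-windowAt (2 * h) S p))
        (sym (trans (length-drop j w) (cong (_∸ j) (length-windowAt (3 * h) S (p ∸ j)))))
        (m+n≤o⇒m≤o∸n _ (⊓-glb
          (≤-trans (+-mono-≤ (m⊓n≤m (2 * h) (length S ∸ p)) (<⇒≤ j<h)) (≤-reflexive (+-comm (2 * h) h)))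
          (≤-trans (+-monoˡ-≤ j (m⊓n≤n (2 * h) (length S ∸ p))) room)))
        where
        room : length S ∸ p + j ≤ length S ∸ (p ∸ j)
        room = m+n≤o⇒m≤o∸n (length S ∸ p + j) (≤-reflexive
          (trans (+-assoc (length S ∸ p) j (p ∸ j))
            (trans (cong (length S ∸ p +_) (m+[n∸m]≡n j≤p)) (m∸n+n≡m p≤))))

Spaced⇒Unique : ∀ {h ps} → 1 ≤ h → Spaced h ps → Unique ps
Spaced⇒Unique 1≤h = AllPairs.map λ { {p} le refl → contradiction (≤-trans (+-monoʳ-≤ p 1≤h) le) (m+1+n≰m p) }

module _ {A : Set} (X Y Z : List A) where

  -- The windows of length 3h starting at p ∸ j for j < h are fresh and
  -- start at pairwise distinct positions.
  spaced-fresh-bound : ∀ {h ps Fs} → IsLZ (X ++ Y ++ Z) Fs → 1 ≤ h → Spaced h ps →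
    All (λ p → p < length (X ++ Z) × Fresh (2 * h) (X ++ Z) p) ps →
    length ps ≤ suc (3 * suc (length Fs))
  spaced-fresh-bound {ps = []} _ _ _ _ = z≤n
  -- The first start is set aside and costs the outer `suc`. All others are at least `h`, so `p ∸ j`
  -- is never truncated at zero.
  spaced-fresh-bound {h} {p₀ ∷ ps} {Fs} lz 1≤h (far ∷ spaced) (_ ∷ fresh) =
    s≤s (*-cancelʳ-≤ (length ps) (3 * suc (length Fs)) h {{>-nonZero 1≤h}} count)
    where
    pos : ℕ × ℕ → ℕ
    pos (p , j) = p ∸ j
    is : List (ℕ × ℕ)
    is = cartesianProduct ps (upTo h)
    split : ∀ {p j} → (p , j) ∈ is → p ∈ ps × j < h × j ≤ p
    split i with p∈ , j∈ ← ∈-cartesianProduct⁻ ps (upTo h) i =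
      p∈ , ∈-upTo⁻ j∈ , ≤-trans (<⇒≤ (∈-upTo⁻ j∈)) (≤-trans (m≤n+m h p₀) (All.lookup far p∈))
    apart : ∀ {p q i} j → p + h ≤ q → i < h → i ≤ q → ¬ p ∸ j ≡ q ∸ i
    apart {p} {q} {i} j p+h≤q i<h i≤q e = <⇒≱ (+-monoʳ-< p i<h) (≤-trans p+h≤q
      (subst (_≤ p + i) (m∸n+n≡m i≤q) (+-monoˡ-≤ i (subst (_≤ p) e (m∸n≤m p j)))))
    pos-inj : ∀ {i j} → i ∈ is → j ∈ is → pos i ≡ pos j → i ≡ j
    pos-inj {p , j} {q , i} pj∈ qi∈ e
      with p∈ , j<h , j≤p ← split pj∈ | q∈ , i<h , i≤q ← split qi∈
      with AllPairs-compare spaced p∈ q∈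
    ... | inj₁ refl      = cong (p ,_) (∸-cancelˡ-≡ j≤p i≤q e)
    ... | inj₂ (inj₁ lt) = contradiction e (apart j lt i<h i≤q)
    ... | inj₂ (inj₂ gt) = contradiction (sym e) (apart i gt j<h j≤p)
    fresh′ : ∀ {i} → i ∈ is → pos i < length (X ++ Z) × Fresh (3 * h) (X ++ Z) (pos i)
    fresh′ {p , j} pj∈ with p∈ , j<h , j≤p ← split pj∈ with p< , f ← All.lookup fresh p∈ =
      ≤-<-trans (m∸n≤m p j) p< , fresh-extend h p j j<h j≤p (<⇒≤ p<) f
    count : length ps * h ≤ 3 * suc (length Fs) * h
    count = subst₂ _≤_
      (trans (length-cartesianProduct ps (upTo h)) (cong (length ps *_) (length-upTo h)))
      (trans (sym (*-assoc (suc (length Fs)) 3 h)) (cong (_* h) (*-comm (suc (length Fs)) 3)))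
      (fresh-count X Y Z pos lz (≤-trans 1≤h (m≤m+n h _))
        (cartesianProduct⁺ (Spaced⇒Unique 1≤h spaced) (upTo⁺ h)) pos-inj fresh′)

  deletion-upper : ∀ {n Fs Gs} → IsLZ (X ++ Y ++ Z) Fs → IsLZ (X ++ Z) Gs → length (X ++ Y ++ Z) ≡ n →
    1 ≤ ⌊log₂ n ⌋ → 1 ≤ length Fs → length Gs ≤ 15 * (⌊log₂ n ⌋ * length Fs)
  deletion-upper {n} {Fs} {Gs} lzT lzS refl 1≤L 1≤f = begin
    length Gs                                     ≤⟨ length≤classes (suc L) lzS (s≤s (⌊log₂⌋-mono-≤ shorter)) ⟩
    suc (sumTo (suc L) _)                         ≤⟨ s≤s (sumTo-≤-* (suc L) class≤) ⟩
    -- `1 ≤ L * f`, `suc L ≤ L + L` and `4 + 3 * f ≤ 7 * f` lead to the constant `1 + 2 * 7`.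
    suc (suc L * suc (3 * suc f))                 ≤⟨ +-mono-≤ 1≤Lf (*-mono-≤ (+-monoˡ-≤ L 1≤L) 4+3f≤7f) ⟩
    L * f + (L + L) * (7 * f)                     ≡⟨ arith L f ⟩
    15 * (L * f)                                  ∎
    where
    open ≤-Reasoning
    L = ⌊log₂ n ⌋
    f = length Fs
    shorter : length (X ++ Z) ≤ n
    shorter = subst₂ _≤_ (sym (length-++ X)) (sym (length-++ X))
      (+-monoʳ-≤ (length X) (subst (length Z ≤_) (sym (length-++ Y)) (m≤n+m (length Z) (length Y))))
    class≤ : ∀ k → length (classStarts k 0 Gs) ≤ suc (3 * suc f)
    class≤ k = spaced-fresh-bound lzT (m^n>0 2 k) (proj₂ (classStarts-spaced k lzS)) (classStarts-fresh k lzS)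
    1≤Lf : 1 ≤ L * f
    1≤Lf = *-mono-≤ 1≤L 1≤f
    4+3f≤7f : suc (3 * suc f) ≤ 7 * f
    4+3f≤7f = subst₂ _≤_ (cong suc (sym (*-suc 3 f))) (sym (*-distribʳ-+ f 4 3))
      (+-monoˡ-≤ (3 * f) (*-monoʳ-≤ 4 1≤f))
    arith : ∀ L f → L * f + (L + L) * (7 * f) ≡ 15 * (L * f)
    arith = solve-∀

-- Lower bound

Letter : Set
Letter = ℕ × Bool

-- The tag `t` gives each column its own two letters, so that occurrences can only align column by
-- column. Column `t` turns on between rows `t` and `suc t`.
cell : ℕ → ℕ → Letter
cell s t = t , (t <ᵇ s)

row : List ℕ → ℕ → List Letter
row Q s = map (cell s) Q

rows : List ℕ → List ℕ → List Letter
rows Q = concatMap (row Q)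

cell-on : ∀ s s′ {t} → cell s′ t ≡ cell s t → t < s → t < s′
cell-on s s′ {t} e t<s = <ᵇ⇒< t s′ (subst T (sym (cong proj₂ e)) (<⇒<ᵇ t<s))

cell-off : ∀ s s′ {t} → cell s′ t ≡ cell s t → s ≤ t → s′ ≤ t
cell-off s s′ e s≤t = ≮⇒≥ λ t<s′ → <⇒≱ (cell-on s′ s (sym e) t<s′) s≤t

-- Fixes the alignment of an occurrence within a row: its first letter reveals the column.
index-unique : ∀ {A : Set} (P : List A) {a N N′} x → Unique (P ++ a ∷ N) →
               drop x (P ++ a ∷ N) ≡ a ∷ N′ → x ≡ length P
index-unique []      zero    _        _    = refl
index-unique []      {a} {N} (suc x) (a∉ ∷ _) e =
  contradiction refl (All.lookup a∉ (∈-drop⁻ x N (subst (a ∈_) (sym e) (here refl))))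
index-unique (p ∷ P) zero    (p∉ ∷ _) refl = contradiction refl (All.lookup p∉ (∈-++⁺ʳ P (here refl)))
index-unique (p ∷ P) (suc x) (_ ∷ u)  e    = cong suc (index-unique P x u e)

module _ {Q : List ℕ} {P a M b R} (uniq : Unique Q) (Q≡ : Q ≡ P ++ a ∷ M ++ b ∷ R) where

  word : ℕ → List Letter
  word s = map (cell s) (a ∷ M ++ b ∷ [])

  -- The tags force the occurrence to start at column `a`. It then reaches column `b` in the same
  -- row, so its first and last letters compare rows `s` and `s′` in these columns.
  row-occurrence : ∀ s s′ {x rest} → x < length Q → word s ≼ drop x (row Q s′ ++ rest) →
                   x ≡ length P × cell s′ a ≡ cell s a × cell s′ b ≡ cell s b
  row-occurrence s s′ {x} {rest} x<Q w≼ = go (drop x Q) refl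
    (subst (word s ≼_) (trans (drop-++-≤ x (row Q s′) rest (subst (x ≤_) (sym (length-map (cell s′) Q)) (<⇒≤ x<Q)))
                              (cong (_++ rest) (drop-map x Q))) w≼)
    where
    final : ∀ M → map (cell s) (M ++ b ∷ []) ≼ map (cell s′) (M ++ b ∷ R) ++ rest → cell s′ b ≡ cell s b
    final []      (e ∷ _) = sym e
    final (_ ∷ M) (_ ∷ p) = final M p
    go : ∀ D → drop x Q ≡ D → word s ≼ map (cell s′) D ++ rest →
         x ≡ length P × cell s′ a ≡ cell s a × cell s′ b ≡ cell s b
    go [] e _ = contradiction (trans (sym (length-drop x Q)) (cong length e)) (m>n⇒m∸n≢0 x<Q)
    go (d ∷ D) e (c ∷ p) with refl ← cong proj₁ c
      with refl ← index-unique P x (subst Unique Q≡ uniq) (trans (cong (drop x) (sym Q≡)) e)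
      with refl ← ∷-injectiveʳ (trans (sym e) (trans (cong (drop (length P)) Q≡)
                    (trans (cong (λ i → drop i (P ++ a ∷ M ++ b ∷ R)) (sym (+-identityʳ (length P))))
                      (drop-++-+ P (a ∷ M ++ b ∷ R) 0)))) =
      refl , sym c , final M p

  -- Whole rows are peeled off until the start lies in the first one left. This cannot be row `s`
  -- itself, where a start before column `a` would be misaligned.
  rows-occurrence : ∀ s {rest} prev x → x < length (rows Q prev) + length P →
                    word s ≼ drop x (rows Q prev ++ row Q s ++ rest) →
                    ∃[ s′ ] s′ ∈ prev × cell s′ a ≡ cell s a × cell s′ b ≡ cell s b
  rows-occurrence s [] x x<P w≼ = contradiction (proj₁ (row-occurrence s s x<Q w≼)) (<⇒≢ x<P)
    where
    x<Q : x < length Q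
    x<Q = ≤-trans x<P (subst (length P ≤_) (sym (trans (cong length Q≡) (length-++ P))) (m≤m+n _ _))
  rows-occurrence s {rest} (s′ ∷ prev) x x< w≼ with x <? length Q
  ... | yes x<Q = s′ , here refl ,
    proj₂ (row-occurrence s s′ x<Q (subst (λ S → word s ≼ drop x S) (++-assoc (row Q s′) (rows Q prev) _) w≼))
  ... | no x≮Q with r , refl ← m≤n⇒∃[o]m+o≡n (≮⇒≥ x≮Q)
    with s″ , s″∈ , e ← rows-occurrence s prev r
      (+-cancelˡ-< (length Q) r _ (subst (length Q + r <_)
        (trans (cong (_+ length P) (trans (length-++ (row Q s′)) (cong (_+ length (rows Q prev)) (length-map (cell s′) Q))))
          (+-assoc (length Q) _ (length P))) x<))
      (subst (word s ≼_) (trans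
        (cong₂ drop (cong (_+ r) (sym (length-map (cell s′) Q))) (++-assoc (row Q s′) (rows Q prev) _))
        (drop-++-+ (row Q s′) _ r)) w≼) =
    s″ , there s″∈ , e

-- Row s has the letters a on and b off, a pattern that no earlier row shows.
data FlipPairs (prev : List ℕ) (s : ℕ) : List ℕ → ℕ → Set where
  []   : FlipPairs prev s [] 0
  pair : ∀ {a b us m} → a < s → s ≤ b → All (λ s′ → s′ ≤ a ⊎ b < s′) prev →
         FlipPairs prev s us m → FlipPairs prev s (a ∷ b ∷ us) (suc m)

⊆-uncons : ∀ {A : Set} {x : A} {xs ys} → (x ∷ xs) ⊆ ys → ∃[ M ] ∃[ R ] ys ≡ M ++ x ∷ R × xs ⊆ R
⊆-uncons (y ∷ʳ τ) with M , R , refl , τ′ ← ⊆-uncons τ = y ∷ M , R , refl , τ′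
⊆-uncons {ys = y ∷ ys} (refl ∷ τ) = [] , ys , refl , τ

-- The pairs form a sublist of the row, so the segments from each `a` to its `b` are disjoint. A
-- segment is new because no earlier row has `a` on and `b` off. `P` is the part of the row already
-- passed.
row-windows : ∀ {Q us m m′} prev {s} after P {R} → Unique Q → Q ≡ P ++ R → us ⊆ R → FlipPairs prev s us m →
  NewWindows {S = rows Q (prev ++ s ∷ after)} (length (rows Q (prev ++ s ∷ []))) m′ →
  NewWindows {S = rows Q (prev ++ s ∷ after)} (length (rows Q prev) + length P) (m + m′)
row-windows {Q} prev {s} after P {R} uniq Q≡ τ [] ws = NewWindows-weaken
  (subst (length (rows Q prev) + length P ≤_)
    (sym (trans (cong length (concatMap-++ (row Q) prev (s ∷ [])))
      (trans (length-++ (rows Q prev)) (cong (length (rows Q prev) +_)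
        (trans (cong length (++-identityʳ (row Q s))) (length-map (cell s) Q))))))
    (+-monoʳ-≤ (length (rows Q prev)) (subst (length P ≤_) (sym (trans (cong length Q≡) (length-++ P))) (m≤m+n _ _))))
  ws
row-windows {Q} {m′ = m′} prev {s} after P uniq Q≡ τ (pair {a} {b} {m = m} a<s s≤b old pairs) ws
  with M₁ , R₁ , refl , τ₁ ← ⊆-uncons τ
  with M₂ , R₂ , refl , τ₂ ← ⊆-uncons τ₁ =
  window l≥ (s≤s z≤n) w≼ new
    (subst (λ l → NewWindows {S = rows Q (prev ++ s ∷ after)} l (m + m′)) shift
      (row-windows prev after P₂ uniq Q≡₂ τ₂ pairs ws))
  where
  U = rows Q prev
  P₁ = P ++ M₁
  P₂ = P₁ ++ a ∷ M₂ ++ b ∷ []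
  w = map (cell s) (a ∷ M₂ ++ b ∷ [])
  l = length U + length P₁
  Q≡₁ : Q ≡ P₁ ++ a ∷ M₂ ++ b ∷ R₂
  Q≡₁ = trans Q≡ (sym (++-assoc P M₁ _))
  Q≡₂ : Q ≡ P₂ ++ R₂
  Q≡₂ = trans Q≡₁ (sym (trans (++-assoc P₁ _ R₂) (cong (λ V → P₁ ++ a ∷ V) (++-assoc M₂ (b ∷ []) R₂))))
  l≥ : length U + length P ≤ l
  l≥ = +-monoʳ-≤ (length U) (subst (length P ≤_) (sym (length-++ P)) (m≤m+n _ _))
  S≡ : rows Q (prev ++ s ∷ after) ≡ U ++ row Q s ++ rows Q after
  S≡ = concatMap-++ (row Q) prev (s ∷ after)
  shift : length U + length P₂ ≡ l + length w
  shift = trans (cong (length U +_) (trans (length-++ P₁) (cong (length P₁ +_) (sym (length-map (cell s) (a ∷ M₂ ++ b ∷ []))))))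
                (sym (+-assoc (length U) (length P₁) _))
  w≼ : w ≼ drop l (rows Q (prev ++ s ∷ after))
  w≼ = subst (w ≼_) (sym at) (≼-trans (≼-++ w (map (cell s) R₂)) (≼-++ _ (rows Q after)))
    where
    open ≡-Reasoning
    at : drop l (rows Q (prev ++ s ∷ after)) ≡ (w ++ map (cell s) R₂) ++ rows Q after
    at = begin
      drop l (rows Q (prev ++ s ∷ after))                        ≡⟨ cong (drop l) S≡ ⟩
      drop l (U ++ row Q s ++ rows Q after)                      ≡⟨ drop-++-+ U _ (length P₁) ⟩
      drop (length P₁) (row Q s ++ rows Q after)                 ≡⟨ cong (λ q → drop (length P₁) (map (cell s) q ++ rows Q after)) Q≡₂ ⟩
      drop (length P₁) (map (cell s) (P₂ ++ R₂) ++ rows Q after) ≡⟨ cong (λ V → drop (length P₁) (map (cell s) V ++ rows Q after)) (++-assoc P₁ _ R₂) ⟩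
      drop (length P₁) (map (cell s) (P₁ ++ (a ∷ M₂ ++ b ∷ []) ++ R₂) ++ rows Q after)
        ≡⟨ cong (λ V → drop (length P₁) (V ++ rows Q after)) (map-++ (cell s) P₁ _) ⟩
      drop (length P₁) ((map (cell s) P₁ ++ map (cell s) ((a ∷ M₂ ++ b ∷ []) ++ R₂)) ++ rows Q after)
        ≡⟨ cong (drop (length P₁)) (++-assoc (map (cell s) P₁) _ _) ⟩
      drop (length P₁) (map (cell s) P₁ ++ map (cell s) ((a ∷ M₂ ++ b ∷ []) ++ R₂) ++ rows Q after)
        ≡⟨ cong (λ i → drop i (map (cell s) P₁ ++ map (cell s) ((a ∷ M₂ ++ b ∷ []) ++ R₂) ++ rows Q after))
             (trans (sym (length-map (cell s) P₁)) (sym (+-identityʳ _))) ⟩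
      drop (length (map (cell s) P₁) + 0) (map (cell s) P₁ ++ map (cell s) ((a ∷ M₂ ++ b ∷ []) ++ R₂) ++ rows Q after)
        ≡⟨ drop-++-+ (map (cell s) P₁) _ 0 ⟩
      map (cell s) ((a ∷ M₂ ++ b ∷ []) ++ R₂) ++ rows Q after
        ≡⟨ cong (_++ rows Q after) (map-++ (cell s) (a ∷ M₂ ++ b ∷ []) R₂) ⟩
      (w ++ map (cell s) R₂) ++ rows Q after ∎
  new : ¬ OccursBefore (rows Q (prev ++ s ∷ after)) l w
  new (x , x<l , occ)
    with s′ , s′∈ , ea , eb ← rows-occurrence uniq Q≡₁ s prev x x<l (subst (λ S → w ≼ drop x S) S≡ occ)
    with All.lookup old s′∈
  ... | inj₁ s′≤a = <⇒≱ (cell-on s s′ ea a<s) s′≤a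
  ... | inj₂ b<s′ = <⇒≱ b<s′ (cell-off s s′ eb s≤b)

-- Bit reversal and recursive bisection

pairUp : ℕ → List ℕ → List ℕ
pairUp h []       = []
pairUp h (t ∷ ts) = t ∷ t + h ∷ pairUp h ts

-- The bit-reversal permutation of 0 , … , 2 ^ k ∸ 1.
bitReversal : ℕ → List ℕ
bitReversal zero    = 0 ∷ []
bitReversal (suc k) = pairUp (2 ^ k) (bitReversal k)

-- The interior of [lo , lo + 2 ^ k], each interval listed with its midpoint first.
midpoints : ℕ → ℕ → List ℕ
midpoints zero    lo = []
midpoints (suc k) lo = lo + 2 ^ k ∷ midpoints k lo ++ midpoints k (lo + 2 ^ k)

-- The number of new windows found while an interval of length `2 ^ k` is bisected; it is half of
-- `k * 2 ^ k`.
flips : ℕ → ℕ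
flips zero    = 0
flips (suc k) = 2 ^ k + (flips k + flips k)

2*flips : ∀ k → 2 * flips k ≡ k * 2 ^ k
2*flips zero    = refl
2*flips (suc k) = trans (step (2 ^ k) (flips k))
  (trans (cong (λ x → 2 * 2 ^ k + 2 * x) (2*flips k)) (step′ (2 ^ k) k))
  where
  step : ∀ x w → 2 * (x + (w + w)) ≡ 2 * x + 2 * (2 * w)
  step = solve-∀
  step′ : ∀ x k → 2 * x + 2 * (k * x) ≡ suc k * (2 * x)
  step′ = solve-∀

length-pairUp : ∀ h ts → length (pairUp h ts) ≡ 2 * length ts
length-pairUp h []       = refl
length-pairUp h (t ∷ ts) = trans (cong (suc ∘ suc) (length-pairUp h ts)) (sym (*-suc 2 (length ts)))

length-bitReversal : ∀ k → length (bitReversal k) ≡ 2 ^ k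
length-bitReversal zero    = refl
length-bitReversal (suc k) = trans (length-pairUp (2 ^ k) (bitReversal k)) (cong (2 *_) (length-bitReversal k))

∈-pairUp⁻ : ∀ h ts {u} → u ∈ pairUp h ts → ∃[ t ] t ∈ ts × (u ≡ t ⊎ u ≡ t + h)
∈-pairUp⁻ h (t ∷ ts) (here refl)         = t , here refl , inj₁ refl
∈-pairUp⁻ h (t ∷ ts) (there (here refl)) = t , here refl , inj₂ refl
∈-pairUp⁻ h (t ∷ ts) (there (there i)) with t′ , t′∈ , e ← ∈-pairUp⁻ h ts i = t′ , there t′∈ , e

pairUp-unique : ∀ {h ts} → All (_< h) ts → Unique ts → Unique (pairUp h ts)
pairUp-unique [] [] = []
pairUp-unique {h} {t ∷ ts} (t<h ∷ ts<h) (t∉ ∷ u) =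
  (<⇒≢ (m<m+n t (≤-<-trans z≤n t<h)) ∷ All.tabulate fresh₁) ∷ All.tabulate fresh₂ ∷ pairUp-unique ts<h u
  where
  fresh₁ : ∀ {x} → x ∈ pairUp h ts → t ≢ x
  fresh₁ i refl with ∈-pairUp⁻ h ts i
  ... | t′ , t′∈ , inj₁ refl = All.lookup t∉ t′∈ refl
  ... | t′ , t′∈ , inj₂ refl = <⇒≱ t<h (m≤n+m h t′)
  fresh₂ : ∀ {x} → x ∈ pairUp h ts → t + h ≢ x
  fresh₂ i refl with ∈-pairUp⁻ h ts i
  ... | t′ , t′∈ , inj₁ refl = <⇒≱ (All.lookup ts<h t′∈) (m≤n+m h t)
  ... | t′ , t′∈ , inj₂ e    = All.lookup t∉ t′∈ (+-cancelʳ-≡ h t t′ e)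

bitReversal-< : ∀ k → All (_< 2 ^ k) (bitReversal k)
bitReversal-< zero    = s≤s z≤n ∷ []
bitReversal-< (suc k) = All.tabulate λ i → bound (∈-pairUp⁻ (2 ^ k) (bitReversal k) i)
  where
  bound : ∀ {u} → ∃[ t ] t ∈ bitReversal k × (u ≡ t ⊎ u ≡ t + 2 ^ k) → u < 2 ^ suc k
  bound (t , t∈ , inj₁ refl) = ≤-trans (All.lookup (bitReversal-< k) t∈) (m≤m+n _ _)
  bound (t , t∈ , inj₂ refl) = subst (t + 2 ^ k <_) (cong (2 ^ k +_) (sym (+-identityʳ (2 ^ k))))
    (+-monoˡ-< (2 ^ k) (All.lookup (bitReversal-< k) t∈))

bitReversal-unique : ∀ k → Unique (bitReversal k)
bitReversal-unique zero    = [] ∷ []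
bitReversal-unique (suc k) = pairUp-unique (bitReversal-< k) (bitReversal-unique k)

⊆-pairUpˡ : ∀ h ts → ts ⊆ pairUp h ts
⊆-pairUpˡ h []       = []
⊆-pairUpˡ h (t ∷ ts) = refl ∷ (t + h) ∷ʳ ⊆-pairUpˡ h ts

⊆-pairUpʳ : ∀ h ts → map (_+ h) ts ⊆ pairUp h ts
⊆-pairUpʳ h []       = []
⊆-pairUpʳ h (t ∷ ts) = t ∷ʳ refl ∷ ⊆-pairUpʳ h ts

∈-bitReversal : ∀ k {t} → t < 2 ^ k → t ∈ bitReversal k
∈-bitReversal zero    (s≤s z≤n) = here refl
∈-bitReversal (suc k) {t} t< with t <? 2 ^ k
... | yes t<h = lookup (⊆-pairUpˡ (2 ^ k) (bitReversal k)) (∈-bitReversal k t<h)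
... | no  t≮h with r , refl ← m≤n⇒∃[o]m+o≡n (≮⇒≥ t≮h) =
  subst (_∈ bitReversal (suc k)) (+-comm r (2 ^ k))
    (lookup (⊆-pairUpʳ (2 ^ k) (bitReversal k)) (∈-map⁺ (_+ 2 ^ k) (∈-bitReversal k
      (subst (r <_) (+-identityʳ (2 ^ k)) (+-cancelˡ-< (2 ^ k) r _ t<)))))

midpoints-≤ : ∀ k lo → All (_≤ lo + 2 ^ k) (midpoints k lo)
midpoints-≤ zero    lo = []
midpoints-≤ (suc k) lo = mid≤ ∷ ++⁺ (All.map (λ s≤ → ≤-trans s≤ mid≤) (midpoints-≤ k lo))
  (subst (λ hi → All (_≤ hi) (midpoints k (lo + 2 ^ k)))
    (trans (+-assoc lo (2 ^ k) (2 ^ k)) (cong (λ x → lo + (2 ^ k + x)) (sym (+-identityʳ (2 ^ k)))))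
    (midpoints-≤ k (lo + 2 ^ k)))
  where
  mid≤ : lo + 2 ^ k ≤ lo + 2 ^ suc k
  mid≤ = +-monoʳ-≤ lo (m≤m+n (2 ^ k) _)

length-midpoints : ∀ k lo → suc (length (midpoints k lo)) ≡ 2 ^ k
length-midpoints zero    lo = refl
length-midpoints (suc k) lo = trans
  (cong (suc ∘ suc) (length-++ (midpoints k lo)))
  (trans (cong suc (sym (+-suc (length (midpoints k lo)) _)))
    (trans (cong₂ _+_ (length-midpoints k lo) (length-midpoints k (lo + 2 ^ k)))
      (cong (2 ^ k +_) (sym (+-identityʳ (2 ^ k))))))

-- At time `lo + h`, column `lo + t` is on and its neighbour `lo + (t + h)` is off. At times up to
-- `lo` the former is still off, and from `lo + (h + h)` on the latter is already on.
midpoint-flips : ∀ {prev} lo h ts → All (_< h) ts → All (λ s → s ≤ lo ⊎ lo + (h + h) ≤ s) prev →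
                 FlipPairs prev (lo + h) (map (lo +_) (pairUp h ts)) (length ts)
midpoint-flips lo h []       []           out = []
midpoint-flips lo h (t ∷ ts) (t<h ∷ ts<h) out = pair (+-monoʳ-< lo t<h) (+-monoʳ-≤ lo (m≤n+m h t))
  (All.map (λ { (inj₁ s≤lo) → inj₁ (≤-trans s≤lo (m≤m+n lo t))
              ; (inj₂ hi≤s) → inj₂ (≤-trans (+-monoʳ-< lo (+-monoˡ-< h t<h)) hi≤s) }) out)
  (midpoint-flips lo h ts ts<h out)

-- Induction on the bisection, with two invariants: earlier rows lie outside the interior of the
-- interval, and its columns appear in `Q` in bit-reversed order. Both halves inherit the order, as
-- the first and the second entries of the pairs.
midpoints-windows : ∀ {Q S m} k lo prev after → Unique Q → map (lo +_) (bitReversal k) ⊆ Q →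
  All (λ s → s ≤ lo ⊎ lo + 2 ^ k ≤ s) prev → S ≡ rows Q (prev ++ midpoints k lo ++ after) →
  NewWindows {S = S} (length (rows Q (prev ++ midpoints k lo))) m →
  NewWindows {S = S} (length (rows Q prev)) (flips k + m)
midpoints-windows {Q} {S} {m} zero lo prev after uniq sub out S≡ ws =
  subst (λ p → NewWindows {S = S} (length (rows Q p)) m) (++-identityʳ prev) ws
midpoints-windows {Q} {m = m} (suc k) lo prev after uniq sub out refl ws =
  subst₂ (NewWindows {S = S}) (+-identityʳ _) count
    (row-windows prev ((left ++ right) ++ after) [] uniq refl sub
      (midpoint-flips lo h (bitReversal k) (bitReversal-< k) out′)
      (midpoints-windows k lo prev₁ (right ++ after) uniq subˡ out₁ (cong (rows Q) (sym eq₁))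
        (midpoints-windows k mid prev₂ after uniq subʳ out₂
          (cong (rows Q) (sym (trans (++-assoc prev₁ left (right ++ after)) eq₁)))
          (subst (λ p → NewWindows {S = S} (length (rows Q p)) m) (sym eq₂) ws))))
  where
  h = 2 ^ k
  mid = lo + h
  left = midpoints k lo
  right = midpoints k mid
  prev₁ = prev ++ mid ∷ []
  prev₂ = prev₁ ++ left
  S = rows Q (prev ++ mid ∷ (left ++ right) ++ after)
  count : length (bitReversal k) + (flips k + (flips k + m)) ≡ flips (suc k) + m
  count = trans (cong₂ _+_ (length-bitReversal k) (sym (+-assoc (flips k) (flips k) m)))
                (sym (+-assoc h _ m))
  eq₁ : prev₁ ++ left ++ right ++ after ≡ prev ++ mid ∷ (left ++ right) ++ after
  eq₁ = trans (++-assoc prev (mid ∷ []) _) (cong (λ V → prev ++ mid ∷ V) (sym (++-assoc left right after)))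
  eq₂ : prev₂ ++ right ≡ prev ++ mid ∷ left ++ right
  eq₂ = trans (++-assoc prev₁ left right) (++-assoc prev (mid ∷ []) (left ++ right))
  hi : lo + 2 ^ suc k ≡ lo + (h + h)
  hi = cong (λ x → lo + (h + x)) (+-identityʳ h)
  out′ : All (λ s → s ≤ lo ⊎ lo + (h + h) ≤ s) prev
  out′ = subst (λ x → All (λ s → s ≤ lo ⊎ x ≤ s) prev) hi out
  out₁ : All (λ s → s ≤ lo ⊎ mid ≤ s) prev₁
  out₁ = ++⁺ (All.map (Sum.map₂ (≤-trans (+-monoʳ-≤ lo (m≤m+n h _)))) out) (inj₂ ≤-refl ∷ [])
  -- Once the left half has been listed, all its times and the midpoint are at most the left end of
  -- the right half.
  out₂ : All (λ s → s ≤ mid ⊎ mid + h ≤ s) prev₂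
  out₂ = ++⁺ (++⁺
      (All.map (Sum.map (λ s≤ → ≤-trans s≤ (m≤m+n lo h)) (≤-trans (≤-reflexive (+-assoc lo h h)))) out′)
      (inj₁ ≤-refl ∷ []))
    (All.map inj₁ (midpoints-≤ k lo))
  subˡ : map (lo +_) (bitReversal k) ⊆ Q
  subˡ = ⊆-trans (Sublist.map⁺ (lo +_) (⊆-pairUpˡ h (bitReversal k))) sub
  subʳ : map (mid +_) (bitReversal k) ⊆ Q
  subʳ = ⊆-trans (subst (_⊆ map (lo +_) (bitReversal (suc k)))
      (trans (sym (map-∘ (bitReversal k)))
             (map-cong (λ t → trans (cong (lo +_) (+-comm t h)) (sym (+-assoc lo h t))) (bitReversal k)))
      (Sublist.map⁺ (lo +_) (⊆-pairUpʳ h (bitReversal k)))) sub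

scrambledRows : ℕ → List Letter
scrambledRows k = rows (bitReversal k) (midpoints k 0)

scrambledRows-lower : ∀ k {Fs} → IsLZ (scrambledRows k) Fs → flips k ≤ length Fs
scrambledRows-lower k {Fs} lz = subst (_≤ length Fs) (+-identityʳ (flips k)) (NewWindows-≤ lz
  (midpoints-windows k 0 [] [] (bitReversal-unique k) (⊆-reflexive (map-id (bitReversal k))) []
    (cong (rows (bitReversal k)) (sym (++-identityʳ (midpoints k 0)))) none))

-- Explicit parses

module _ {A : Set} where

  -- The source starts in `U` but may run into `F`, as in an overlapping copy.
  Source : List A → List A → Set
  Source U F = length F ≤ 1 ⊎ (∃[ p ] p < length U × F ≼ drop p (U ++ F))

  infixr 5 _∷_

  -- Carries the text read so far in place of a position, so that parses compose without index
  -- arithmetic.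
  data Parse (U : List A) : List A → ℕ → Set where
    []  : Parse U [] 0
    _∷_ : ∀ {F V m} → Source U F → Parse (U ++ F) V m → Parse U (F ++ V) (suc m)

  Parse⇒Factorization : ∀ {S U V m} → S ≡ U ++ V → Parse U V m → Factorization {S = S} (length U) m
  Parse⇒Factorization {U = U} refl [] = end (cong length (sym (++-identityʳ U)))
  Parse⇒Factorization {S} {U} refl (_∷_ {F} {V} src p) = piece F≼ (Sum.map₂ occurs src)
    (subst (λ b → Factorization {S = S} b _) (length-++ U) (Parse⇒Factorization (sym (++-assoc U F V)) p))
    where
    F≼ : F ≼ drop (length U) (U ++ F ++ V)
    F≼ = subst (F ≼_) (sym (trans (cong (λ i → drop i (U ++ F ++ V)) (sym (+-identityʳ (length U))))
      (drop-++-+ U (F ++ V) 0))) (≼-++ F V)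
    occurs : ∃[ p ] p < length U × F ≼ drop p (U ++ F) → OccursBefore (U ++ F ++ V) (length U) F
    occurs (p , p<U , F≼p) = p , p<U , subst (F ≼_)
      (trans (sym (drop-++-≤ p (U ++ F) V (≤-trans (<⇒≤ p<U) (subst (length U ≤_) (sym (length-++ U)) (m≤m+n _ _)))))
             (cong (drop p) (++-assoc U F V)))
      (≼-trans F≼p (≼-++ _ V))

  Infix : List A → List A → Set
  Infix F U = ∃[ X ] ∃[ Y ] U ≡ X ++ F ++ Y

  Infix-++ : ∀ {F U} V → Infix F U → Infix F (U ++ V)
  Infix-++ {F} V (X , Y , refl) = X , Y ++ V , trans (++-assoc X (F ++ Y) V) (cong (X ++_) (++-assoc F Y V))

  ++-Infix : ∀ {F U} V → Infix F U → Infix F (V ++ U)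
  ++-Infix {F} V (X , Y , refl) = V ++ X , Y , sym (++-assoc V X _)

  Infix-trans : ∀ {F G U} → Infix F G → Infix G U → Infix F U
  Infix-trans {F} (X , Y , refl) (X′ , Y′ , refl) = ++-Infix X′ (Infix-++ Y′ (X , Y , refl))

  infix-source : ∀ {F U} → Infix F U → Source U F
  infix-source {[]} _ = inj₁ z≤n
  infix-source {c ∷ F} (X , Y , refl) = inj₂ (length X ,
    subst (length X <_) (sym (length-++ X)) (m<m+n (length X) (s≤s z≤n)) ,
    subst (c ∷ F ≼_) (sym at) (≼-trans (≼-++ (c ∷ F) Y) (≼-++ _ _)))
    where
    at : drop (length X) ((X ++ c ∷ F ++ Y) ++ c ∷ F) ≡ (c ∷ F ++ Y) ++ c ∷ F
    at = trans (cong₂ drop (sym (+-identityʳ (length X))) (++-assoc X (c ∷ F ++ Y) (c ∷ F)))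
               (drop-++-+ X _ 0)

  parse-letters : ∀ {U V m} F → Parse (U ++ F) V m → Parse U (F ++ V) (length F + m)
  parse-letters {U} {V} {m} [] p = subst (λ W → Parse W V m) (++-identityʳ U) p
  parse-letters {U} {V} {m} (c ∷ F) p = inj₁ ≤-refl ∷
    parse-letters F (subst (λ W → Parse W V m) (sym (++-assoc U (c ∷ []) F)) p)

  parse-change : ∀ {U V m F G c} → Infix F U → Infix G U →
                 Parse (U ++ F ++ c ∷ G) V m → Parse U ((F ++ c ∷ G) ++ V) (3 + m)
  parse-change {U} {V} {m} {F} {G} {c} F⊑ G⊑ p =
    subst (λ W → Parse U W (3 + m)) (sym (++-assoc F (c ∷ G) V))
      (infix-source F⊑ ∷ inj₁ ≤-refl ∷ infix-source (Infix-++ (c ∷ []) (Infix-++ F G⊑)) ∷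
        subst (λ W → Parse W V m)
          (trans (sym (++-assoc U F (c ∷ G))) (sym (++-assoc (U ++ F) (c ∷ []) G))) p)

cell-suc : ∀ s {t} → t ≢ s → cell (suc s) t ≡ cell s t
cell-suc s {t} t≢s with t <? s
... | yes t<s = cong (t ,_) (trans (dec-true (t <? suc s) (m<n⇒m<1+n t<s)) (sym (dec-true (t <? s) t<s)))
... | no  t≮s = cong (t ,_) (trans
  (dec-false (t <? suc s) λ { (s≤s t≤s) → t≮s (≤∧≢⇒< t≤s t≢s) }) (sym (dec-false (t <? s) t≮s)))

module _ {Q : List ℕ} (uniq : Unique Q) where

  -- Only column `s` changes, and it occurs once in `Q`. The parts of the row before and after it
  -- are copied, and the changed letter is a piece of its own.
  parse-next-row : ∀ {U V m s} → s ∈ Q → Infix (row Q s) U →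
                   Parse (U ++ row Q (suc s)) V m → Parse U (row Q (suc s) ++ V) (3 + m)
  parse-next-row {U} {V} {m} {s} s∈ old p with P , R , refl ← ∈-∃++ s∈ =
    subst (λ W → Parse U (W ++ V) (3 + m)) (sym changed)
      (parse-change (Infix-trans P⊑ old) (Infix-trans R⊑ old) (subst (λ W → Parse (U ++ W) V m) changed p))
    where
    s∉P : ∀ P → Unique (P ++ s ∷ R) → All (_≢ s) P
    s∉P []      _        = []
    s∉P (x ∷ P) (x∉ ∷ u) = All.lookup x∉ (∈-++⁺ʳ P (here refl)) ∷ s∉P P u
    s∉R : ∀ P → Unique (P ++ s ∷ R) → All (_≢ s) R
    s∉R []      (s∉ ∷ _) = All.map (λ s≢t t≡s → s≢t (sym t≡s)) s∉
    s∉R (_ ∷ P) (_ ∷ u)  = s∉R P u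
    changed : row Q (suc s) ≡ map (cell s) P ++ cell (suc s) s ∷ map (cell s) R
    changed = trans (map-++ (cell (suc s)) P (s ∷ R)) (cong₂ (λ X Y → X ++ cell (suc s) s ∷ Y)
      (map-cong-local (All.map (cell-suc s) (s∉P P uniq)))
      (map-cong-local (All.map (cell-suc s) (s∉R P uniq))))
    P⊑ : Infix (map (cell s) P) (row Q s)
    P⊑ = [] , _ , map-++ (cell s) P (s ∷ R)
    R⊑ : Infix (map (cell s) R) (row Q s)
    R⊑ = map (cell s) P ++ cell s s ∷ [] , [] , trans (map-++ (cell s) P (s ∷ R))
      (trans (sym (++-assoc (map (cell s) P) (cell s s ∷ []) _))
             (cong ((map (cell s) P ++ cell s s ∷ []) ++_) (sym (++-identityʳ (map (cell s) R)))))

  parse-successive-rows : ∀ {U V m s} j → (∀ {t} → t < s + j → t ∈ Q) → Infix (row Q s) U →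
    Parse (U ++ rows Q (iterate suc (suc s) j)) V m → Parse U (rows Q (iterate suc (suc s) j) ++ V) (3 * j + m)
  parse-successive-rows {U} {V} {m} zero    all old p = subst (λ W → Parse W V m) (++-identityʳ U) p
  parse-successive-rows {U} {V} {m} {s} (suc j) all old p =
    subst₂ (Parse U) (sym (++-assoc (row Q (suc s)) _ V)) (cong (_+ m) (sym (*-suc 3 j)))
      (parse-next-row (all (m<m+n s (s≤s z≤n))) old
        (parse-successive-rows j (λ {t} t< → all (subst (t <_) (sym (+-suc s j)) t<))
          (U , [] , cong (U ++_) (sym (++-identityʳ _)))
          (subst (λ W → Parse W V m) (sym (++-assoc U (row Q (suc s)) _)) p)))

  parse-old-rows : ∀ {U} ss → All (λ s → Infix (row Q s) U) ss → Parse U (rows Q ss) (length ss)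
  parse-old-rows []       []          = []
  parse-old-rows (s ∷ ss) (old ∷ olds) = infix-source old ∷ parse-old-rows ss (All.map (Infix-++ (row Q s)) olds)

  row-infix : ∀ {s ss} → s ∈ ss → Infix (row Q s) (rows Q ss)
  row-infix {s} s∈ with P , R , refl ← ∈-∃++ s∈ = rows Q P , rows Q R , concatMap-++ (row Q) P (s ∷ R)

∈-iterate-suc : ∀ s n {t} → s ≤ t → t < s + n → t ∈ iterate suc s n
∈-iterate-suc s zero    s≤t t< = contradiction s≤t (<⇒≱ (subst (_ <_) (+-identityʳ s) t<))
∈-iterate-suc s (suc n) {t} s≤t t< with s ≟ t
... | yes refl = here refl
... | no  s≢t  = there (∈-iterate-suc (suc s) n (≤∧≢⇒< s≤t s≢t) (subst (t <_) (+-suc s n) t<))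

-- Rows in order and padding

orderedRows : ℕ → List Letter
orderedRows k = rows (bitReversal k) (iterate suc 0 (suc (2 ^ k)))

padding : ℕ → List Letter
padding e = replicate e (0 , true)

-- A letter and an overlapping copy from position 0. For `e = 0`, two empty pieces keep the count
-- uniform.
parse-padding : ∀ {V m} e → Parse (padding e) V m → Parse [] (padding e ++ V) (2 + m)
parse-padding zero p = _∷_ {F = []} (inj₁ z≤n) (_∷_ {F = []} (inj₁ z≤n) p)
parse-padding (suc e) p = inj₁ ≤-refl ∷ inj₂ (0 , s≤s z≤n , shifted e) ∷ p
  where
  shifted : ∀ e → padding e ≼ padding (suc e)
  shifted zero    = []
  shifted (suc e) = refl ∷ shifted e

-- Two pieces for the padding, `D` letters for row 0, three pieces for each of the next `D` rows,
-- and one for each of the `D ∸ 1` scrambled rows, all of which have occurred by then.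
padded-rows-upper : ∀ k e {Fs} → IsLZ ((padding e ++ orderedRows k) ++ scrambledRows k) Fs →
                    length Fs ≤ 7 * 2 ^ k
padded-rows-upper k e {Fs} lz = ≤-trans (LZ-optimal (Parse⇒Factorization S≡ parse) z≤n lz) total
  where
  D = 2 ^ k
  Q = bitReversal k
  O = rows Q (iterate suc 1 D)
  S≡ : (padding e ++ orderedRows k) ++ scrambledRows k ≡ padding e ++ row Q 0 ++ O ++ scrambledRows k
  S≡ = trans (++-assoc (padding e) _ _) (cong (padding e ++_) (++-assoc (row Q 0) O _))
  old : All (λ s → Infix (row Q s) ((padding e ++ row Q 0) ++ O)) (midpoints k 0)
  old = All.map (λ {s} s≤ → subst (Infix (row Q s)) (sym (++-assoc (padding e) (row Q 0) O))
      (++-Infix (padding e) (row-infix (bitReversal-unique k) (∈-iterate-suc 0 (suc D) z≤n (s≤s s≤)))))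
    (midpoints-≤ k 0)
  parse : Parse [] (padding e ++ row Q 0 ++ O ++ scrambledRows k)
            (2 + (length (row Q 0) + (3 * D + length (midpoints k 0))))
  parse = parse-padding e (parse-letters (row Q 0)
    (parse-successive-rows (bitReversal-unique k) D (∈-bitReversal k)
      (padding e , [] , cong (padding e ++_) (sym (++-identityʳ _)))
      (parse-old-rows (bitReversal-unique k) (midpoints k 0) old)))
  total : 2 + (length (row Q 0) + (3 * D + length (midpoints k 0))) ≤ 7 * D
  total = begin
    2 + (length (row Q 0) + (3 * D + length (midpoints k 0)))
      ≡⟨ cong (λ x → 2 + (x + (3 * D + length (midpoints k 0)))) (trans (length-map (cell 0) Q) (length-bitReversal k)) ⟩
    2 + (D + (3 * D + length (midpoints k 0)))
      ≤⟨ +-mono-≤ (*-monoʳ-≤ 2 (m^n>0 2 k)) (+-monoʳ-≤ D (+-monoʳ-≤ (3 * D) (≤-trans (n≤1+n _) (≤-reflexive (length-midpoints k 0))))) ⟩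
    2 * D + (D + (3 * D + D))
      ≡⟨ arith D ⟩
    7 * D ∎
    where
    open ≤-Reasoning
    arith : ∀ D → 2 * D + (D + (3 * D + D)) ≡ 7 * D
    arith = solve-∀

length-rows : ∀ Q ss → length (rows Q ss) ≡ length ss * length Q
length-rows Q []       = refl
length-rows Q (s ∷ ss) = trans (length-++ (row Q s)) (cong₂ _+_ (length-map (cell s) Q) (length-rows Q ss))

-- There are `D + 1` ordered and `D ∸ 1` scrambled rows of `D` letters each, in total `2 * (D * D)`
-- letters.
length-orderedRows+scrambledRows : ∀ k → length (orderedRows k) + length (scrambledRows k) ≡ 2 ^ suc (2 * k)
length-orderedRows+scrambledRows k = begin
  length (orderedRows k) + length (scrambledRows k)
    ≡⟨ cong₂ _+_ (length-rows Q (iterate suc 0 (suc D))) (length-rows Q (midpoints k 0)) ⟩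
  length (iterate suc 0 (suc D)) * length Q + l * length Q
    ≡⟨ cong₂ (λ x y → x * y + l * y) (length-iterate suc 0 (suc D)) (length-bitReversal k) ⟩
  suc D * D + l * D
    ≡⟨ arith D l ⟩
  (D + suc l) * D
    ≡⟨ cong (λ x → (D + x) * D) (length-midpoints k 0) ⟩
  (D + D) * D
    ≡⟨ arith′ D ⟩
  2 * (D * D)
    ≡⟨ cong (2 *_) (sym (trans (cong (2 ^_) (cong (k +_) (+-identityʳ k))) (^-distribˡ-+-* 2 k k))) ⟩
  2 ^ suc (2 * k) ∎
  where
  open ≡-Reasoning
  Q = bitReversal k
  D = 2 ^ k
  l = length (midpoints k 0)
  arith : ∀ D l → suc D * D + l * D ≡ (D + suc l) * D
  arith = solve-∀
  arith′ : ∀ D → (D + D) * D ≡ 2 * (D * D)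
  arith′ = solve-∀

_≟ᴸ_ : DecidableEquality Letter
_≟ᴸ_ = Product.≡-dec _≟_ Bool._≟_

-- The padding reaches every length `n`. It belongs to the deleted block, so the string that remains
-- does not depend on it.
paddedDeletion : ∀ n k → 2 ^ suc (2 * k) ≤ n → Deletion n
paddedDeletion n k core≤n = record
  { _≟_ = _≟ᴸ_ ; A = [] ; B = padding e ++ orderedRows k ; C = scrambledRows k ; length[ABC]≡n = len }
  where
  e = n ∸ 2 ^ suc (2 * k)
  len : length ((padding e ++ orderedRows k) ++ scrambledRows k) ≡ n
  len = trans (cong length (++-assoc (padding e) _ _)) (trans (length-++ (padding e))
    (trans (cong₂ _+_ (length-replicate e) (trans (length-++ (orderedRows k)) (length-orderedRows+scrambledRows k)))
      (m∸n+n≡m core≤n)))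

bisect : ∀ m → ∃[ k ] 2 * k ≤ m × m ≤ suc (2 * k)
bisect zero          = 0 , z≤n , z≤n
bisect (suc zero)    = 0 , z≤n , ≤-refl
bisect (suc (suc m)) with k , lo , hi ← bisect m =
  suc k , subst (_≤ suc (suc m)) (sym (*-suc 2 k)) (s≤s (s≤s lo)) ,
  subst (λ x → suc (suc m) ≤ suc x) (sym (*-suc 2 k)) (s≤s (s≤s hi))

-- From phrase counts to ratios

product-fraction : ∀ a b .{{_ : NonZero b}} L → (ℤ.+ a ℚ./ b) ℚ.* (ℤ.+ L ℚ./ 1) ≡ ℤ.+ (a * L) ℚ./ b
product-fraction a b@(suc b′) L = ℚ.toℚᵘ-injective (begin
  ℚ.toℚᵘ ((ℤ.+ a ℚ./ b) ℚ.* (ℤ.+ L ℚ./ 1))         ≈⟨ ℚ.toℚᵘ-homo-* (ℤ.+ a ℚ./ b) (ℤ.+ L ℚ./ 1) ⟩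
  ℚ.toℚᵘ (ℤ.+ a ℚ./ b) ℚᵘ.* ℚ.toℚᵘ (ℤ.+ L ℚ./ 1)   ≈⟨ ℚᵘ.*-cong (ℚ.toℚᵘ-fromℚᵘ (mkℚᵘ (ℤ.+ a) b′))
                                                                (ℚ.toℚᵘ-fromℚᵘ (mkℚᵘ (ℤ.+ L) 0)) ⟩
  mkℚᵘ (ℤ.+ a) b′ ℚᵘ.* mkℚᵘ (ℤ.+ L) 0              ≈⟨ ℚᵘ.*≡* (cong₂ ℤ._*_ (sym (ℤ.pos-* a L))
                                                                (cong ℤ.+_ (sym (*-identityʳ b)))) ⟩
  mkℚᵘ (ℤ.+ (a * L)) b′                            ≈⟨ ℚ.toℚᵘ-fromℚᵘ (mkℚᵘ (ℤ.+ (a * L)) b′) ⟨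
  ℚ.toℚᵘ (ℤ.+ (a * L) ℚ./ b)                       ∎)
  where open ≈-Reasoning ℚᵘ.≃-setoid

fraction-mono : ∀ p q r s .{{_ : NonZero q}} .{{_ : NonZero s}} → p * s ≤ r * q →
                ℤ.+ p ℚ./ q ℚ.≤ ℤ.+ r ℚ./ s
fraction-mono p q@(suc q′) r s@(suc s′) le = ℚ.toℚᵘ-cancel-≤
  (ℚᵘ.≤-respˡ-≃ (ℚᵘ.≃-sym (ℚ.toℚᵘ-fromℚᵘ (mkℚᵘ (ℤ.+ p) q′)))
    (ℚᵘ.≤-respʳ-≃ (ℚᵘ.≃-sym (ℚ.toℚᵘ-fromℚᵘ (mkℚᵘ (ℤ.+ r) s′)))
      (ℚᵘ.*≤* (subst₂ ℤ._≤_ (ℤ.pos-* p s) (ℤ.pos-* r q) (ℤ.+≤+ le)))))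

ratio-upper : ∀ {n} .{{_ : NonZero n}} (d : Deletion n) → 1 ≤ ⌊log₂ n ⌋ →
              ratio d ℚ.≤ (ℤ.+ 15 ℚ./ 1) ℚ.* log n
ratio-upper {n} d 1≤L = subst (ratio d ℚ.≤_) (sym (product-fraction 15 1 L))
  (fraction-mono z[AC] z[ABC] (15 * L) 1 {{z[ABC]-nonZero d}}
    (subst₂ _≤_ (sym (*-identityʳ z[AC])) (sym (*-assoc 15 L z[ABC]))
      (deletion-upper A B C (proj₂ (lz _≟ᴬ_ (A ++ B ++ C))) (proj₂ (lz _≟ᴬ_ (A ++ C))) length[ABC]≡n 1≤L
        (>-nonZero⁻¹ z[ABC] {{z[ABC]-nonZero d}}))))
  where
  open Deletion d renaming (_≟_ to _≟ᴬ_)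
  L = ⌊log₂ n ⌋
  z[AC] = z _≟ᴬ_ (A ++ C)
  z[ABC] = z _≟ᴬ_ (A ++ B ++ C)

ratio-lower : ∀ n .{{_ : NonZero n}} k (core≤n : 2 ^ suc (2 * k) ≤ n) → ⌊log₂ n ⌋ ≤ 4 * k →
              (ℤ.+ 1 ℚ./ 56) ℚ.* log n ℚ.≤ ratio (paddedDeletion n k core≤n)
ratio-lower n k core≤n L≤4k = subst (ℚ._≤ ratio d) (sym (product-fraction 1 56 L))
  (fraction-mono (1 * L) 56 z[AC] z[ABC] {{_}} {{z[ABC]-nonZero d}} bound)
  where
  d = paddedDeletion n k core≤n
  open Deletion d renaming (_≟_ to _≟ᴬ_)
  L = ⌊log₂ n ⌋
  z[AC] = z _≟ᴸ_ (A ++ C)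
  z[ABC] = z _≟ᴸ_ (A ++ B ++ C)
  open ≤-Reasoning
  bound : 1 * L * z[ABC] ≤ z[AC] * 56
  bound = begin
    -- The factor 56 is `4 * 7 * 2`: 4 from `L ≤ 4 * k`, 7 from the parse of the padded rows, and 2
    -- from the closed form of `flips k`.
    1 * L * z[ABC]          ≤⟨ *-mono-≤ (≤-trans (≤-reflexive (*-identityˡ L)) L≤4k)
                                 (padded-rows-upper k (n ∸ 2 ^ suc (2 * k)) (proj₂ (lz _≟ᴸ_ (A ++ B ++ C)))) ⟩
    4 * k * (7 * 2 ^ k)     ≡⟨ arith k (2 ^ k) ⟩
    28 * (k * 2 ^ k)        ≡⟨ cong (28 *_) (sym (2*flips k)) ⟩
    28 * (2 * flips k)      ≡⟨ arith′ (flips k) ⟩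
    flips k * 56            ≤⟨ *-monoˡ-≤ 56 (scrambledRows-lower k (proj₂ (lz _≟ᴸ_ (A ++ C)))) ⟩
    z[AC] * 56              ∎
    where
    arith : ∀ k D → 4 * k * (7 * D) ≡ 28 * (k * D)
    arith = solve-∀
    arith′ : ∀ w → 28 * (2 * w) ≡ w * 56
    arith′ = solve-∀

corollary10 : DSub ∈Θ log
-- From `n = 8` on the logarithm is at least 3, which forces `1 ≤ k` in the lower bound and hence
-- `2 + 2 * k ≤ 4 * k`.
corollary10 = ℤ.+ 1 ℚ./ 56 , ℤ.+ 15 ℚ./ 1 , 8 ,
  toWitness {a? = 0ℚ ℚ.<? ℤ.+ 1 ℚ./ 56} _ , toWitness {a? = 0ℚ ℚ.<? ℤ.+ 15 ℚ./ 1} _ ,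
  λ n 8≤n → lower n 8≤n , upper n 8≤n
  where
  3≤log : ∀ n → 8 ≤ n → 3 ≤ ⌊log₂ n ⌋
  3≤log n 8≤n = subst (_≤ ⌊log₂ n ⌋) (⌊log₂[2^n]⌋≡n 3) (⌊log₂⌋-mono-≤ 8≤n)
  lower : ∀ n .{{_ : NonZero n}} → 8 ≤ n → (ℤ.+ 1 ℚ./ 56) ℚ.* log n ℚ.≤ DSub n
  -- This choice makes `suc (2 * k)` equal to the logarithm of `n` or one less, so the rows fit into
  -- length `n`.
  lower n 8≤n with k , lo , hi ← bisect (pred ⌊log₂ n ⌋) =
    ℚ.≤-trans (ratio-lower n k core≤n L≤4k) (proj₂ (DSub-isMaxRatio n) (paddedDeletion n k core≤n))
    where
    L≡ : suc (pred ⌊log₂ n ⌋) ≡ ⌊log₂ n ⌋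
    L≡ = suc-pred ⌊log₂ n ⌋ {{>-nonZero (≤-trans (s≤s z≤n) (3≤log n 8≤n))}}
    core≤n : 2 ^ suc (2 * k) ≤ n
    core≤n = ≤-trans (^-monoʳ-≤ 2 (subst (suc (2 * k) ≤_) L≡ (s≤s lo)))
                     (2^⌊log₂n⌋≤n n (≤-trans (s≤s z≤n) 8≤n))
    1≤k : 1 ≤ k
    1≤k = *-cancelˡ-< 2 0 k (s≤s⁻¹ (≤-trans (s≤s⁻¹ (subst (3 ≤_) (sym L≡) (3≤log n 8≤n))) hi))
    L≤4k : ⌊log₂ n ⌋ ≤ 4 * k
    L≤4k = begin
      ⌊log₂ n ⌋         ≡⟨ sym L≡ ⟩
      suc (pred ⌊log₂ n ⌋)  ≤⟨ s≤s hi ⟩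
      2 + 2 * k         ≤⟨ +-monoˡ-≤ (2 * k) (*-monoʳ-≤ 2 1≤k) ⟩
      2 * k + 2 * k     ≡⟨ sym (*-distribʳ-+ k 2 2) ⟩
      4 * k             ∎
      where open ≤-Reasoning
  upper : ∀ n .{{_ : NonZero n}} → 8 ≤ n → DSub n ℚ.≤ (ℤ.+ 15 ℚ./ 1) ℚ.* log n
  upper n 8≤n = let (d , ratio≡) = proj₁ (DSub-isMaxRatio n) in ℚ.≤-trans
    (ℚ.≤-reflexive (sym ratio≡)) (ratio-upper d (≤-trans (s≤s z≤n) (3≤log n 8≤n)))
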